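{- Let $\mathbb{F}_q$ be a finite field of order $q=p^s$ with $p$ prime. Let $P_1,\dots,P_r \in \mathbb{F}_q[t_1,\dots,t_n]$ be nonzero polynomials, and let $\mathcal{I}\subseteq\{1,\dots,n\}$ be a nonempty subset such that $\max_{1\le j\le r}w_{p,\mathcal{I}}(P_j)>0$. Let $f_1,\dots,f_n \in \mathbb{F}_q[t]$ and assume that $f_i$ is nonconstant for all $i\in\mathcal{I}$. Suppose that $\sum_{j=1}^r w_{p,\mathcal{I}}(P_j) \le \sum_{i\in\mathcal{I}}\frac{1}{w_p(f_i)}$. Then \[ p^{\left\lceil s\left(\sum_{i\in\mathcal{I}}\frac{1}{w_p(f_i)}-\sum_{j=1}^r w_{p,\mathcal{I}}(P_j)\right)/\max_{1\le j\le r} w_{p,\mathcal{I}}(P_j)\right\rceil} \] divides $\# \{ (x_1,\dots,x_n) \in \mathbb{F}_q^n \mid P_j(f_1(x_1),\dots,f_n(x_n)) = 0 \text{ for all } 1 \leq j \leq r\}$.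
   Context: For integers $M\ge 0$ and $N\ge 2$, $\sigma_N(M)$ is the sum of the digits of $M$ in base $N$ (so $\sigma_N(0)=0$). For nonempty $\mathcal{I}\subseteq\{1,\dots,n\}$ and a monomial $a t_1^{m_1}\cdots t_n^{m_n}$ with $a\neq 0$, set $w_{p,\mathcal{I}}(a t_1^{m_1}\cdots t_n^{m_n})=\sum_{i\in\mathcal{I}}\sigma_p(m_i)$; for a polynomial $P$ that is a sum of monomials $Q_1,\dots,Q_\ell$ (its monomial terms), $w_{p,\mathcal{I}}(P)=\max_k w_{p,\mathcal{I}}(Q_k)$. For a univariate polynomial $f=\sum_\ell b_\ell t^{m_\ell}$ ($b_\ell\neq0$), $w_p(f)=\max_\ell \sigma_p(m_\ell)$. -}

module Defs where

open import Level using (0ℓ)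
open import Data.Nat as ℕ using (ℕ; zero; suc; _%_; _/_; _⊔_)
open import Data.Integer as ℤ using (ℤ; +_)
open import Data.Rational as ℚ using (ℚ; 0ℚ)
open import Data.Fin using (Fin; zero; suc)
open import Data.Fin.Subset using (Subset)
open import Data.Vec as Vec using (Vec; []; _∷_; lookup)
open import Data.List as List using (List; []; _∷_; foldr; length; filter; concatMap; map; allFin)
open import Data.Product using (_×_; _,_; proj₁; proj₂; ∃)
open import Data.Bool using (if_then_else_)
open import Function.Bundles using (_↔_; Inverse)
open import Relation.Binary.PropositionalEquality using (_≡_; _≢_)
open import Relation.Binary.Definitions using (DecidableEquality)
open import Relation.Nullary using (Dec; yes; no)
open import Algebra.Structures using (IsCommutativeRing)
open import Data.List.Relation.Unary.All using (All)
open import Data.List.Relation.Unary.Any using (Any)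
open import Data.List.Relation.Unary.Unique.Propositional using (Unique)

-- Digit sum σ_N(M) of M in base N (meaningful for N ≥ 2; set to 0 for
-- N ∈ {0,1}, never used).  Fuel M suffices since M / N < M for M > 0.

σ-fuel : ℕ → (b : ℕ) → ℕ → ℕ
σ-fuel zero          b m = 0
σ-fuel (suc k) zero m = 0
σ-fuel (suc k) (suc zero) m = 0
σ-fuel (suc k) (suc (suc b)) m =
  (m % suc (suc b)) ℕ.+ σ-fuel k (suc (suc b)) (m / suc (suc b))

σ : (N M : ℕ) → ℕ
σ N M = σ-fuel M N M

∑ℕ : (n : ℕ) → (Fin n → ℕ) → ℕ
∑ℕ zero    g = 0
∑ℕ (suc n) g = g zero ℕ.+ ∑ℕ n (λ i → g (suc i))

maxℕ : (n : ℕ) → (Fin n → ℕ) → ℕ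
maxℕ zero    g = 0
maxℕ (suc n) g = g zero ⊔ maxℕ n (λ i → g (suc i))

∑ℚ : (n : ℕ) → (Fin n → ℚ) → ℚ
∑ℚ zero    g = 0ℚ
∑ℚ (suc n) g = g zero ℚ.+ ∑ℚ n (λ i → g (suc i))

∑ℕ[_] : ∀ {n} → Subset n → (Fin n → ℕ) → ℕ
∑ℕ[_] {n} I g = ∑ℕ n (λ i → if lookup I i then g i else 0)

∑ℚ[_] : ∀ {n} → Subset n → (Fin n → ℚ) → ℚ
∑ℚ[_] {n} I g = ∑ℚ n (λ i → if lookup I i then g i else 0ℚ)

-- 1/k as a rational (only applied to k > 0; 1/0 := 0 is a dummy)
recip : ℕ → ℚ
recip zero    = 0ℚ
recip (suc k) = + 1 ℚ./ suc k

record FiniteField : Set₁ where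
  infixl 7 _*_
  infixl 6 _+_
  field
    Carrier           : Set
    _+_ _*_           : Carrier → Carrier → Carrier
    -_                : Carrier → Carrier
    0# 1#             : Carrier
    isCommutativeRing : IsCommutativeRing _≡_ _+_ _*_ -_ 0# 1#
    0≢1               : 0# ≢ 1#
    inverse           : ∀ x → x ≢ 0# → ∃ λ y → x * y ≡ 1#
    _≟_               : DecidableEquality Carrier
    card              : ℕ
    enum              : Fin card ↔ Carrier

  pow : Carrier → ℕ → Carrier
  pow x zero    = 1#
  pow x (suc k) = x * pow x k

  elements : List Carrier
  elements = map (Inverse.to enum) (allFin card)

  points : (n : ℕ) → List (Vec Carrier n)
  points zero    = [] ∷ []
  points (suc n) = concatMap (λ x → map (x ∷_) (points n)) elements

module _ (F : FiniteField) where
  open FiniteField F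

  -- polynomial in t_1..t_n : list of terms a t_1^{m_1} ... t_n^{m_n}
  MPoly : ℕ → Set
  MPoly n = List (Carrier × Vec ℕ n)

  UPoly : Set
  UPoly = List (Carrier × ℕ)

  -- canonical representation: nonzero coefficients, distinct exponents
  WellFormedM : ∀ {n} → MPoly n → Set
  WellFormedM P = All (λ t → proj₁ t ≢ 0#) P × Unique (map proj₂ P)

  WellFormedU : UPoly → Set
  WellFormedU f = All (λ t → proj₁ t ≢ 0#) f × Unique (map proj₂ f)

  -- (for well-formed f) nonconstant = some term has positive degree
  Nonconstant : UPoly → Set
  Nonconstant f = Any (λ t → proj₂ t ≢ 0) f

  evalM : ∀ {n} → MPoly n → Vec Carrier n → Carrier
  evalM {n} P x =
    foldr (λ { (a , m) acc → a * Vec.foldr _ _*_ 1# (Vec.zipWith pow x m) + acc }) 0# P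

  evalU : UPoly → Carrier → Carrier
  evalU f x = foldr (λ { (b , m) acc → b * pow x m + acc }) 0# f

  zeroCount : ∀ {n r} → (Fin r → MPoly n) → (Fin n → UPoly) → ℕ
  zeroCount {n} {r} P f = length (filter dec (points n))
    where
    open import Data.Fin.Properties using (all?)
    subst-f : Vec Carrier n → Vec Carrier n
    subst-f x = Vec.tabulate (λ i → evalU (f i) (lookup x i))
    dec : (x : Vec Carrier n) → Dec (∀ j → evalM (P j) (subst-f x) ≡ 0#)
    dec x = all? (λ j → evalM (P j) (subst-f x) ≟ 0#)

wMono : (p : ℕ) → ∀ {n} → Subset n → Vec ℕ n → ℕ
wMono p I m = ∑ℕ[ I ] (λ i → σ p (lookup m i))

wM : ∀ {A : Set} (p : ℕ) {n} → Subset n → List (A × Vec ℕ n) → ℕ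
wM p I P = foldr (λ t acc → wMono p I (proj₂ t) ⊔ acc) 0 P

wU : ∀ {A : Set} (p : ℕ) → List (A × ℕ) → ℕ
wU p f = foldr (λ t acc → σ p (proj₂ t) ⊔ acc) 0 f

{-# OPTIONS --safe #-}
-- Write q = p^s, let I be the augmentation ideal of the group ring ℤ[F] of (F , +), and for a
-- function u on a set with translations let Δ^t u be its t-fold differences.
--
-- A map φ into F has degree ≤ w if Δ^(w+1) φ = 0; since x ↦ x^(p^i) is additive, x^m has degree
-- at most σ_p(m).  The identity ∂[φ] = [φ]([∂φ] − 1) shows by induction on w that Δ^t [φ] lies in
-- I^k for some k with t ≤ w k.
--
-- For e ∈ F and X = [e] − 1 one has Σ_{c<p} [e]^c ≡ X^(p−1) mod p, hence also X^p ∈ p X ℤ[F].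
-- Along an F_p-basis of F the second fact gives I^k ⊆ p^a ℤ[F] for some a with
-- k ≤ (s + a)(p − 1), so that Δ^t of the indicator of P_j = 0 is divisible by p^a with
-- t ≤ (p − 1) w_j (s + a).  The first fact turns a sum over F into s(p − 1) differences, each
-- p − 1 of which may be traded for a factor p; through f_i they still count as
-- ⌈s(p − 1) / w_p(f_i)⌉ differences.  Together p^e divides the number of zeros for some e with
-- Σ_i ⌈s(p − 1) / w_p(f_i)⌉ ≤ s(p − 1) Σ_j w_j + (p − 1) e max_j w_j.
module Submission where

open import Defs
open import Level using (0ℓ)
open import Algebra.Bundles using (CommutativeRing)
open import Algebra.Structures using (IsAbelianGroup; IsCommutativeRing)
import Algebra.Properties.CommutativeMonoid.Mult as MonoidMult
import Algebra.Properties.CommutativeSemigroup as CommutativeSemigroupProperties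
import Algebra.Properties.Ring as RingProperties
import Algebra.Properties.Semiring.Exp as SemiringExp
import Algebra.Properties.Semiring.Mult as SemiringMult
open import Data.Bool using (Bool; true; false; if_then_else_)
open import Data.Empty using (⊥-elim)
open import Data.Fin as Fin using (Fin; zero; suc; toℕ)
import Data.Fin.Properties as Finₚ
open import Data.Fin.Subset using (Subset; Nonempty; _∈_)
open import Data.Integer as ℤ using (ℤ; 0ℤ; 1ℤ)
import Data.Integer.DivMod as ℤDivMod
import Data.Integer.Properties as ℤₚ
open import Data.Integer.Tactic.RingSolver using (solve-∀)
open import Data.List using (List; []; _∷_; _++_; length; map; concatMap; foldr; filter; allFin; cartesianProductWith)
open import Data.List.Membership.Propositional using (find; lose) renaming (_∈_ to _∈ˡ_)
open import Data.List.Membership.Propositional.Properties using (∈-map⁺; ∈-map⁻; ∈-allFin; ∈-∃++; ∈-++⁺ˡ; ∈-++⁺ʳ; ∈-++⁻; ∈-cartesianProductWith⁺)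
import Data.List.Properties as Listₚ
open import Data.List.Relation.Binary.Permutation.Propositional as Perm using (_↭_; ↭-trans)
import Data.List.Relation.Binary.Permutation.Propositional.Properties as Permₚ
open import Data.List.Relation.Binary.Subset.Propositional using (_⊆_)
open import Data.List.Relation.Unary.All as All using ([]; _∷_)
open import Data.List.Relation.Unary.AllPairs using ([]; _∷_)
open import Data.List.Relation.Unary.Any as Any using (here; there)
open import Data.List.Relation.Unary.Unique.Propositional using (Unique)
import Data.List.Relation.Unary.Unique.Propositional.Properties as Uniqueₚ
open import Data.Nat as ℕ using (ℕ; zero; suc; _≤_; _<_; z≤n; s≤s; _∸_; _!)
open import Data.Nat.Combinatorics using (_C_; nCk+nC[k+1]≡[n+1]C[k+1]; nCn≡1; nCk≡n!/k![n-k]!; k![n∸k]!∣n!; k>n⇒nCk≡0)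
open import Data.Nat.Coprimality using (prime⇒coprime; coprime-Bézout)
import Data.Nat.DivMod as DivMod
open import Data.Nat.Divisibility as ∣ using (_∣_; _∤_; divides)
open import Data.Nat.GCD using (module Bézout)
open import Data.Nat.Primality using (Prime; euclidsLemma; prime⇒nonTrivial; ¬prime[0]; ¬prime[1])
import Data.Nat.Properties as ℕₚ
import Data.Nat.Tactic.RingSolver as ℕ-Solver
open import Data.Product using (_,_; proj₁; proj₂; ∃; ∃₂) renaming (_×_ to infixr 2 _∧_)
open import Data.Rational as ℚ using (ℚ; 0ℚ; 1ℚ; ceiling; floor; ↥_; ↧_; fromℚᵘ)
import Data.Rational.Properties as ℚₚ
open import Data.Rational.Solver using (module +-*-Solver)
open import Data.Rational.Unnormalised as ℚᵘ using (mkℚᵘ; *≡*)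
import Data.Rational.Unnormalised.Properties as ℚᵘₚ
open import Data.Sum as Sum using (inj₁; inj₂)
open import Data.Vec as Vec using (Vec; []; _∷_; lookup)
import Data.Vec.Properties as Vecₚ
open import Function.Bundles using (Inverse; Injection)
open import Function.Properties.Inverse using (Inverse⇒Injection)
open import Relation.Binary.Definitions using (tri<; tri≈; tri>)
open import Relation.Binary.PropositionalEquality as ≡ using (_≡_; _≢_; cong; cong₂)
import Relation.Binary.Reasoning.Setoid as SetoidReasoning
open import Relation.Nullary using (¬_; ¬?; Dec; yes; no)
open import Relation.Nullary.Decidable using (decidable-stable)

-- Filtrations and iterated differences

-- The values of P_j live in characteristic p while divisibility is asked for in ℤ, and no ring
-- homomorphism leads from F to ℤ. The group ring bridges this gap: every g : F → ℤ extends linearly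
-- to ℤ[F], so what is proved for [φ] holds for all g ∘ φ at once. The indicator of 0 is one such g,
-- and no polynomial formula for it is ever needed. The exponent gets its shape from bounds t ≤ d +
-- W e, where t is a number of differences and p^e the divisor they guarantee. In a product the
-- offsets d add up, but the slope W has to be common to all factors, so each slope is weakened to
-- the largest. Hence the sum of the w_j in the numerator and their maximum in the denominator. The
-- factor p - 1 occurs in every term and cancels in the end. Inside the filtrations no quotient is
-- rounded: order at least t / w is expressed as order k for some k with t ≤ w k, and such bounds
-- chain by monotonicity.

module Filtrations (R : CommutativeRing 0ℓ 0ℓ) where
  open CommutativeRing R

  Family : Set₁
  Family = ℕ → Carrier → Set

  shift : Family → Family
  shift V t = V (suc t)

  record IsAdditive (V : Family) : Set where
    field
      resp : ∀ {t x y} → x ≈ y → V t x → V t y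
      zero∈ : ∀ {t} → V t 0#
      add : ∀ {t x y} → V t x → V t y → V t (x + y)

  record IsFiltration (V : Family) : Set where
    field
      isAdditive : IsAdditive V
      anti       : ∀ {t x} → V (suc t) x → V t x
    open IsAdditive isAdditive public

    anti-≤ : ∀ {t t′ x} → t ≤ t′ → V t′ x → V t x
    anti-≤ t≤t′ = go (ℕₚ.≤⇒≤′ t≤t′)
      where
      go : ∀ {t t′ x} → t ℕ.≤′ t′ → V t′ x → V t x
      go ℕ.≤′-refl      v = v
      go (ℕ.≤′-step le) v = go le (anti v)

  shift-additive : ∀ {V} → IsAdditive V → IsAdditive (shift V)
  shift-additive a = record { resp = resp ; zero∈ = zero∈ ; add = add }
    where open IsAdditive a

  shift-filtration : ∀ {V} → IsFiltration V → IsFiltration (shift V)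
  shift-filtration f = record { isAdditive = shift-additive isAdditive ; anti = anti }
    where open IsFiltration f

  Multiplies : Family → Family → Family → Set
  Multiplies U V W = ∀ {a b x y} → U a x → V b y → W (a ℕ.+ b) (x * y)

  module _ (bound : ℕ → ℕ → Set) (V : Family) (V-add : IsAdditive V) where
    -- Re-indexing along a relation instead of a function: for decreasing `V` and `bound t k` equal
    -- to `t ≤ w * k` this is `V` at ⌈t / w⌉, with no division carried out.
    Graded : Family
    Graded t x = ∃ λ k → bound t k ∧ V k x

    Graded-filtration : (∀ {t k} → bound (suc t) k → bound t k) → (∀ t → ∃ (bound t)) →
                        (∀ {k l x} → k ≤ l → V l x → V k x) → IsFiltration Graded
    Graded-filtration bound-anti bound-∃ V-anti = record
      { isAdditive = record
        { resp  = λ { eq (k , b , v) → k , b , resp eq v }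
        ; zero∈ = λ {t} → proj₁ (bound-∃ t) , proj₂ (bound-∃ t) , zero∈
        ; add   = add-Graded }
      ; anti = λ { (k , b , v) → k , bound-anti b , v } }
      where
      open IsAdditive V-add
      add-Graded : ∀ {t x y} → Graded t x → Graded t y → Graded t (x + y)
      add-Graded (k , b , v) (l , c , w) with ℕₚ.≤-total k l
      ... | inj₁ k≤l = k , b , add v (V-anti k≤l w)
      ... | inj₂ l≤k = l , c , add (V-anti l≤k v) w

module Differences (R : CommutativeRing 0ℓ 0ℓ) {Y M : Set} (act : M → Y → Y) where
  open CommutativeRing R
  open Filtrations R public
  open RingProperties ring using (-‿distribˡ-*; -‿distribʳ-*; -‿+-comm)
  open CommutativeSemigroupProperties +-commutativeSemigroup using (interchange)
  open SetoidReasoning setoid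

  ∂ : M → (Y → Carrier) → Y → Carrier
  ∂ m u y = u (act m y) - u y

  Δ : List M → (Y → Carrier) → Y → Carrier
  Δ []       u = u
  Δ (m ∷ ms) u = Δ ms (∂ m u)

  Δ-++ : ∀ ks ms u y → Δ ms (Δ ks u) y ≡ Δ (ks ++ ms) u y
  Δ-++ []       ms u y = ≡.refl
  Δ-++ (k ∷ ks) ms u y = Δ-++ ks ms (∂ k u) y

  Δ-cong : ∀ ms {u v} → (∀ y → u y ≈ v y) → ∀ y → Δ ms u y ≈ Δ ms v y
  Δ-cong []       u≈v y = u≈v y
  Δ-cong (m ∷ ms) u≈v y = Δ-cong ms (λ z → +-cong (u≈v (act m z)) (-‿cong (u≈v z))) y

  Δ-+ : ∀ ms u v y → Δ ms (λ z → u z + v z) y ≈ Δ ms u y + Δ ms v y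
  Δ-+ []       u v y = refl
  Δ-+ (m ∷ ms) u v y = trans
    (Δ-cong ms (λ z → trans (+-congˡ (sym (-‿+-comm (u z) (v z)))) (interchange _ _ _ _)) y)
    (Δ-+ ms (∂ m u) (∂ m v) y)

  Δ-zero : ∀ ms {u} → (∀ y → u y ≈ 0#) → ∀ y → Δ ms u y ≈ 0#
  Δ-zero []       u≈0 y = u≈0 y
  Δ-zero (m ∷ ms) u≈0 y =
    Δ-zero ms (λ z → trans (+-cong (u≈0 _) (-‿cong (u≈0 z))) (-‿inverseʳ 0#)) y

  Δ-invariant : ∀ m ms {u} → (∀ m y → u (act m y) ≈ u y) → ∀ y → Δ (m ∷ ms) u y ≈ 0#
  Δ-invariant m ms {u} inv = Δ-zero ms (λ z → trans (+-congʳ (inv m z)) (-‿inverseʳ (u z)))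

  -- The family is indexed by the number of differences taken, so that vanishing, membership in
  -- powers of an ideal and divisibility are all instances.
  Prof : Family → (Y → Carrier) → Set
  Prof V u = ∀ ms y → V (length ms) (Δ ms u y)

  Prof-cong : ∀ {V} → IsAdditive V → ∀ {u v} → (∀ y → u y ≈ v y) → Prof V u → Prof V v
  Prof-cong a u≈v pu ms y = IsAdditive.resp a (Δ-cong ms u≈v y) (pu ms y)

  Prof-+ : ∀ {V} → IsAdditive V → ∀ {u v} → Prof V u → Prof V v → Prof V (λ y → u y + v y)
  Prof-+ a pu pv ms y = resp (sym (Δ-+ ms _ _ y)) (add (pu ms y) (pv ms y))
    where open IsAdditive a

  -- The translate is u + ∂ m u, and differences of ∂ m u are differences of u of one order more.
  Prof-act : ∀ {V} → IsFiltration V → ∀ {u} m → Prof V u → Prof V (λ y → u (act m y))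
  Prof-act f {u} m pu = Prof-cong isAdditive
    (λ y → trans (sym (+-assoc _ _ _))
             (trans (+-congʳ (+-comm (u y) (u (act m y))))
               (trans (+-assoc _ _ _) (trans (+-congˡ (-‿inverseʳ (u y))) (+-identityʳ _)))))
    (Prof-+ isAdditive pu (λ ms y → anti (pu (m ∷ ms) y)))
    where open IsFiltration f

  -- The asymmetric Leibniz rule: it has no term with a difference in both factors, at the price of
  -- a translate in the second factor, which `Prof-act` handles.
  ∂-* : ∀ x x′ y y′ → x′ * y′ - x * y ≈ (x′ - x) * y′ + x * (y′ - y)
  ∂-* x x′ y y′ = sym (begin
    (x′ - x) * y′ + x * (y′ - y)
      ≈⟨ +-cong (trans (distribʳ y′ x′ (- x)) (+-congˡ (sym (-‿distribˡ-* x y′))))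
                (trans (distribˡ x y′ (- y)) (+-congˡ (sym (-‿distribʳ-* x y)))) ⟩
    (x′ * y′ - x * y′) + (x * y′ - x * y)    ≈⟨ +-assoc _ _ _ ⟩
    x′ * y′ + (- (x * y′) + (x * y′ - x * y)) ≈⟨ +-congˡ (+-assoc _ _ _) ⟨
    x′ * y′ + ((- (x * y′) + x * y′) - x * y) ≈⟨ +-congˡ (+-congʳ (-‿inverseˡ _)) ⟩
    x′ * y′ + (0# - x * y)                   ≈⟨ +-congˡ (+-identityˡ _) ⟩
    x′ * y′ - x * y                          ∎)

  -- Induction on the list for all families at once: each difference falls on one factor and shifts
  -- its family together with `W`, which preserves the multiplication hypothesis.
  Prof-* : ∀ {U V W} → IsFiltration V → IsAdditive W → Multiplies U V W →
           ∀ {u v} → Prof U u → Prof V v → Prof W (λ y → u y * v y)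
  Prof-* fV aW mul pu pv [] y = mul (pu [] y) (pv [] y)
  Prof-* {U} {V} {W} fV aW mul {u} {v} pu pv (m ∷ ms) y =
    resp (sym (Δ-cong ms (λ z → ∂-* (u z) (u (act m z)) (v z) (v (act m z))) y))
      (resp (sym (Δ-+ ms _ _ y))
        (add (Prof-* {shift U} fV (shift-additive aW) mul (λ l → pu (m ∷ l)) (Prof-act fV m pv) ms y)
             (Prof-* {U} {shift V} {shift W} (shift-filtration fV) (shift-additive aW)
               (λ {a} {b} {x} {z} p q → ≡.subst (λ t → W t (x * z)) (ℕₚ.+-suc a b) (mul p q)) pu
                   (λ l → pv (m ∷ l)) ms y)))
    where open IsAdditive aW

-- Powers of an ideal given by generators

module AdicPowers (R : CommutativeRing 0ℓ 0ℓ) {A : Set} (X : A → CommutativeRing.Carrier R) where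
  open CommutativeRing R hiding (_-_; zero) renaming (sym to ≈-sym)

  -- The k-th power of the ideal generated by the `X a`, presented by derivations so that later
  -- proofs can peel off the k generators one at a time.
  data Pow : ℕ → Carrier → Set where
    any  : ∀ {r} → Pow 0 r
    nil  : ∀ {k} → Pow k 0#
    sum  : ∀ {k q r} → Pow k q → Pow k r → Pow k (q + r)
    gen  : ∀ {k r} a → Pow k r → Pow (suc k) (X a * r)
    ≈-resp : ∀ {k q r} → q ≈ r → Pow k q → Pow k r

  Pow-additive : Filtrations.IsAdditive R Pow
  Pow-additive = record { resp = ≈-resp ; zero∈ = nil ; add = sum }

  Pow-anti : ∀ {k r} → Pow (suc k) r → Pow k r
  Pow-anti nil        = nil
  Pow-anti (sum p q)  = sum (Pow-anti p) (Pow-anti q)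
  Pow-anti {zero}  (gen a p) = any
  Pow-anti {suc k} (gen a p) = gen a (Pow-anti p)
  Pow-anti (≈-resp e p) = ≈-resp e (Pow-anti p)

  Pow-filtration : Filtrations.IsFiltration R Pow
  Pow-filtration = record { isAdditive = Pow-additive ; anti = Pow-anti }

  open Filtrations.IsFiltration Pow-filtration public using () renaming (anti-≤ to Pow-anti-≤)

  Pow-*ʳ : ∀ {k r} q → Pow k r → Pow k (r * q)
  Pow-*ʳ q any        = any
  Pow-*ʳ q nil        = ≈-resp (≈-sym (zeroˡ q)) nil
  Pow-*ʳ q (sum p p′) = ≈-resp (≈-sym (distribʳ q _ _)) (sum (Pow-*ʳ q p) (Pow-*ʳ q p′))
  Pow-*ʳ q (gen a p)  = ≈-resp (≈-sym (*-assoc (X a) _ q)) (gen a (Pow-*ʳ q p))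
  Pow-*ʳ q (≈-resp e p) = ≈-resp (*-congʳ e) (Pow-*ʳ q p)

  Pow-* : ∀ {k l q r} → Pow k q → Pow l r → Pow (k ℕ.+ l) (q * r)
  Pow-* {q = q} any pr        = ≈-resp (*-comm _ q) (Pow-*ʳ q pr)
  Pow-* {r = r} nil pr        = ≈-resp (≈-sym (zeroˡ r)) nil
  Pow-* {r = r} (sum p p′) pr = ≈-resp (≈-sym (distribʳ r _ _)) (sum (Pow-* p pr) (Pow-* p′ pr))
  Pow-* {r = r} (gen a p) pr  = ≈-resp (≈-sym (*-assoc (X a) _ r)) (gen a (Pow-* p pr))
  Pow-* (≈-resp e p) pr         = ≈-resp (*-congʳ e) (Pow-* p pr)

  Pow-X : ∀ a → Pow 1 (X a)
  Pow-X a = ≈-resp (*-identityʳ (X a)) (gen a any)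

-- Congruences modulo p and divisibility by powers of p

prime∤! : ∀ {p} → Prime p → ∀ k → k < p → p ∤ k !
prime∤! {p} pr zero k<p p∣1 = ℕₚ.<⇒≱ (ℕ.nonTrivial⇒n>1 p {{prime⇒nonTrivial pr}}) (∣.∣⇒≤ p∣1)
prime∤! pr (suc k) k<p p∣ = Sum.[ (λ p∣1+k → ℕₚ.<⇒≱ k<p (∣.∣⇒≤ p∣1+k)) , prime∤! pr k (ℕₚ.<⇒≤ k<p) ]
  (euclidsLemma (suc k) (k !) pr p∣)

nCk*k![n∸k]! : ∀ {n k} → k ≤ n → (n C k) ℕ.* (k ! ℕ.* (n ∸ k) !) ≡ n !
nCk*k![n∸k]! {n} {k} k≤n = ≡.trans (cong (ℕ._* (k ! ℕ.* (n ∸ k) !)) (nCk≡n!/k![n-k]! k≤n))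
  (DivMod.m/n*n≡m {{k ℕₚ.!* (n ∸ k) !≢0}} (k![n∸k]!∣n! k≤n))

prime∣C : ∀ {p} → Prime p → ∀ {k} → suc k < p → p ∣ p C suc k
prime∣C {suc π} pr {k} k<p with euclidsLemma (suc π C suc k) (suc k ! ℕ.* (suc π ∸ suc k) !) pr
       (∣.∣-trans (∣.m∣m*n (π !)) (∣.∣-reflexive (≡.sym (nCk*k![n∸k]! (ℕₚ.<⇒≤ k<p)))))
... | inj₁ d = d
... | inj₂ d with euclidsLemma (suc k !) ((suc π ∸ suc k) !) pr d
...   | inj₁ d′ = ⊥-elim (prime∤! pr (suc k) k<p d′)
...   | inj₂ d′ = ⊥-elim (prime∤! pr (π ∸ k) (s≤s (ℕₚ.m∸n≤m π k)) d′)

module RingLemmas (R : CommutativeRing 0ℓ 0ℓ) where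
  open CommutativeRing R hiding (zero)
  open SemiringMult semiring public using (_×_; ×-congʳ; ×-congˡ; ×-homo-+; ×-homo-1; ×-assocˡ; ×-assoc-*; ×-comm-*)
  open MonoidMult +-commutativeMonoid using (×-distrib-+)
  open SemiringExp semiring public using (_^_; ^-congˡ)
  open CommutativeSemigroupProperties +-commutativeSemigroup using () renaming (interchange to +-interchange; x∙yz≈y∙xz to x+yz≈y+xz)
  open CommutativeSemigroupProperties *-commutativeSemigroup using () renaming (x∙yz≈y∙xz to x*yz≈y*xz)
  open Filtrations R
  open SetoidReasoning setoid

  ×-zeroʳ : ∀ n → n × 0# ≈ 0#
  ×-zeroʳ zero    = refl
  ×-zeroʳ (suc n) = trans (+-identityˡ _) (×-zeroʳ n)

  ×-*-× : ∀ m n x y → (m × x) * (n × y) ≈ (m ℕ.* n) × (x * y)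
  ×-*-× m n x y = trans (×-assoc-* m x (n × y)) (trans (×-congʳ m (×-comm-* n x y)) (×-assocˡ (x * y) m n))

  Div : ℕ → Carrier → Set
  Div n x = ∃ λ q → x ≈ n × q

  Div-*ˡ : ∀ {n x} c → Div n x → Div n (c * x)
  Div-*ˡ {n} c (q , e) = c * q , trans (*-congˡ e) (×-comm-* n c q)

  Div-* : ∀ {m n x y} → Div m x → Div n y → Div (m ℕ.* n) (x * y)
  Div-* {m} {n} (q , e) (q′ , e′) = q * q′ , trans (*-cong e e′) (×-*-× m n q q′)

  Div-^-additive : ∀ p → IsAdditive (λ k → Div (p ℕ.^ k))
  Div-^-additive p = record
    { resp  = λ { e (q , f) → q , trans (sym e) f }
    ; zero∈ = λ {k} → 0# , sym (×-zeroʳ (p ℕ.^ k))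
    ; add   = λ { {k} (q , e) (q′ , e′) → q + q′ , trans (+-cong e e′) (sym (×-distrib-+ q q′ (p ℕ.^ k))) } }

  Div-^-anti : ∀ p {k l x} → k ≤ l → Div (p ℕ.^ l) x → Div (p ℕ.^ k) x
  Div-^-anti p {k} {l} k≤l (q , e) = (p ℕ.^ (l ∸ k)) × q ,
    trans e (trans (×-congˡ (≡.trans (cong (p ℕ.^_) (≡.sym (ℕₚ.m+[n∸m]≡n k≤l)))
        (ℕₚ.^-distribˡ-+-* p k (l ∸ k))))
      (sym (×-assocˡ q (p ℕ.^ k) (p ℕ.^ (l ∸ k)))))

  -- For w > 0: x has p-adic valuation at least (t − d) / w.
  Val : (p d w : ℕ) → Family
  Val p d w = Graded (λ t e → t ≤ d ℕ.+ w ℕ.* e) (λ e → Div (p ℕ.^ e)) (Div-^-additive p)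

  Val-filtration : ∀ p d w → IsFiltration (Val p d (suc w))
  Val-filtration p d w = Graded-filtration _ (λ e → Div (p ℕ.^ e)) (Div-^-additive p)
    (λ le → ℕₚ.≤-trans (ℕₚ.n≤1+n _) le)
    (λ t → t , ℕₚ.≤-trans (ℕₚ.m≤m+n t (w ℕ.* t)) (ℕₚ.m≤n+m _ d))
    (Div-^-anti p)

  Val-* : ∀ p d d′ w → Multiplies (Val p d w) (Val p d′ w) (Val p (d ℕ.+ d′) w)
  Val-* p d d′ w {a} {b} {x} {y} (e , a≤ , v) (e′ , b≤ , v′) = e ℕ.+ e′ ,
    ℕₚ.≤-trans (ℕₚ.+-mono-≤ a≤ b≤) (ℕₚ.≤-reflexive (lem d d′ w e e′)) ,
    ≡.subst (λ n → Div n (x * y)) (≡.sym (ℕₚ.^-distribˡ-+-* p e e′)) (Div-* {p ℕ.^ e} {p ℕ.^ e′} v v′)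
    where
    lem : ∀ d d′ w e e′ → (d ℕ.+ w ℕ.* e) ℕ.+ (d′ ℕ.+ w ℕ.* e′) ≡ (d ℕ.+ d′) ℕ.+ w ℕ.* (e ℕ.+ e′)
    lem = ℕ-Solver.solve-∀

  Val-*ˡ : ∀ p d w {t x} c → Val p d w t x → Val p d w t (c * x)
  Val-*ˡ p d w c (e , le , v) = e , le , Div-*ˡ {p ℕ.^ e} c v

  Val-0 : ∀ p d w {x} → Val p d w 0 x
  Val-0 p d w {x} = 0 , z≤n , x , sym (×-homo-1 x)

  geom : Carrier → ℕ → Carrier
  geom T zero    = 0#
  geom T (suc n) = 1# + T * geom T n

  horner : (ℕ → ℕ) → ℕ → Carrier → Carrier
  horner f zero    x = 0#
  horner f (suc n) x = f 0 × 1# + x * horner (λ k → f (suc k)) n x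

  horner-cong : ∀ {f g} → (∀ k → f k ≡ g k) → ∀ n x → horner f n x ≈ horner g n x
  horner-cong f≗g zero    x = refl
  horner-cong f≗g (suc n) x = +-cong (×-congˡ (f≗g 0)) (*-congˡ (horner-cong (λ k → f≗g (suc k)) n x))

  horner-+ : ∀ f g n x → horner (λ k → f k ℕ.+ g k) n x ≈ horner f n x + horner g n x
  horner-+ f g zero    x = sym (+-identityˡ 0#)
  horner-+ f g (suc n) x = trans
    (+-cong (×-homo-+ 1# (f 0) (g 0)) (trans (*-congˡ (horner-+ (λ k → f (suc k)) (λ k → g (suc k)) n x))
        (distribˡ x _ _)))
    (+-interchange _ _ _ _)

  horner-trim : ∀ f n x → f n ≡ 0 → horner f (suc n) x ≈ horner f n x
  horner-trim f zero    x fn≡0 = trans (+-cong (×-congˡ fn≡0) (zeroʳ x)) (+-identityˡ 0#)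
  horner-trim f (suc n) x fn≡0 = +-congˡ (*-congˡ (horner-trim (λ k → f (suc k)) n x fn≡0))

  -- Both sides stand for ((1 + x)^n - 1) / x. As x need not be cancellable, the identity is proved
  -- by induction with Pascal's rule.
  geom-binomial : ∀ x n → geom (1# + x) n ≈ horner (λ k → n C suc k) n x
  geom-binomial x zero    = refl
  geom-binomial x (suc n) = begin
    1# + (1# + x) * geom (1# + x) n            ≈⟨ +-congˡ
        (trans (*-congˡ (geom-binomial x n)) (distribʳ h 1# x)) ⟩
    1# + (1# * h + x * h)                      ≈⟨ +-congˡ (+-congʳ (*-identityˡ h)) ⟩
    1# + (h + x * h)                           ≈⟨ x+yz≈y+xz 1# h (x * h) ⟩
    h + (1# + x * h)                           ≈⟨ +-comm h _ ⟩
    (1# + x * h) + h                           ≈⟨ +-cong (+-congʳ (×-homo-1 1#))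
        (horner-trim (λ k → n C suc k) n x (k>n⇒nCk≡0 (ℕₚ.n<1+n n))) ⟨
    horner (n C_) (suc n) x + horner (λ k → n C suc k) (suc n) x ≈⟨ horner-+ (n C_) (λ k → n C suc k)
        (suc n) x ⟨
    horner (λ k → n C k ℕ.+ n C suc k) (suc n) x ≈⟨ horner-cong (nCk+nC[k+1]≡[n+1]C[k+1] n) (suc n) x ⟩
    horner (λ k → suc n C suc k) (suc n) x     ∎
    where h = horner (λ k → n C suc k) n x

  horner-mod : ∀ p f n x → (∀ k → k < n → p ∣ f k) → f n ≡ 1 → ∃ λ q → horner f (suc n) x ≈ x ^ n + p × q
  horner-mod p f zero    x _ fn≡1 = 0# , +-cong (trans (×-congˡ fn≡1) (×-homo-1 1#))
      (trans (zeroʳ x) (sym (×-zeroʳ p)))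
  horner-mod p f (suc n) x d fn≡1 with horner-mod p (λ k → f (suc k)) n x
      (λ k k<n → d (suc k) (s≤s k<n)) fn≡1 | d 0 (s≤s z≤n)
  ... | q , e | divides c f0≡c*p = c × 1# + x * q , (begin
    f 0 × 1# + x * horner (λ k → f (suc k)) (suc n) x ≈⟨ +-cong
        (trans (×-congˡ (≡.trans f0≡c*p (ℕₚ.*-comm c p))) (sym (×-assocˡ 1# p c))) (*-congˡ e) ⟩
    p × (c × 1#) + x * (x ^ n + p × q)   ≈⟨ +-congˡ (trans (distribˡ x _ _) (+-congˡ (×-comm-* p x q))) ⟩
    p × (c × 1#) + (x * x ^ n + p × (x * q)) ≈⟨ x+yz≈y+xz _ _ _ ⟩
    x * x ^ n + (p × (c × 1#) + p × (x * q)) ≈⟨ +-congˡ (×-distrib-+ (c × 1#) (x * q) p) ⟨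
    x * x ^ n + p × (c × 1# + x * q)     ∎)

  -- All coefficients of ((1 + x)^p - 1) / x except the leading one are binomials C(p, k) with 0 < k
  -- < p.
  geom-mod-prime : ∀ {π} → Prime (suc π) → ∀ x → ∃ λ q → geom (1# + x) (suc π) ≈ x ^ π + suc π × q
  geom-mod-prime {π} pr x with horner-mod (suc π) (λ k → suc π C suc k) π x (λ k k<π → prime∣C pr (s≤s k<π))
      (nCn≡1 (suc π))
  ... | q , e = q , trans (geom-binomial x (suc π)) e

  *-geom : ∀ x n → 1# + x * geom (1# + x) n ≈ (1# + x) ^ n
  *-geom x zero    = trans (+-congˡ (zeroʳ x)) (+-identityʳ 1#)
  *-geom x (suc n) = begin
    1# + x * (1# + (1# + x) * g)           ≈⟨ +-congˡ
        (trans (distribˡ x _ _) (+-cong (*-identityʳ x) (x*yz≈y*xz x _ g))) ⟩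
    1# + (x + (1# + x) * (x * g))          ≈⟨ +-assoc _ _ _ ⟨
    (1# + x) + (1# + x) * (x * g)          ≈⟨ +-congʳ (*-identityʳ _) ⟨
    (1# + x) * 1# + (1# + x) * (x * g)     ≈⟨ distribˡ _ _ _ ⟨
    (1# + x) * (1# + x * g)                ≈⟨ *-congˡ (*-geom x n) ⟩
    (1# + x) * (1# + x) ^ n                ∎
    where g = geom (1# + x) n

  x^p+px : ∀ {π} → Prime (suc π) → ∀ x → ∃ λ q → (1# + x) ^ suc π ≈ 1# + (x ^ suc π + suc π × (x * q))
  x^p+px {π} pr x with geom-mod-prime pr x
  ... | q , e = q , trans (sym (*-geom x (suc π)))
      (+-congˡ (trans (*-congˡ e) (trans (distribˡ x _ _) (+-congˡ (×-comm-* (suc π) x q)))))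

  -- The factor x that survives on the right is decisive: a factor p then costs p - 1 factors x
  -- instead of p, and this is the source of every p - 1 in the later bounds.
  PowerRule : ℕ → Carrier → Set
  PowerRule p x = ∃ λ q → x ^ p ≈ p × (x * q)

  unipotent⇒PowerRule : ∀ {π} → Prime (suc π) → ∀ x → (1# + x) ^ suc π ≈ 1# → PowerRule (suc π) x
  unipotent⇒PowerRule {π} pr x unip with x^p+px pr x
  ... | q , e = - q , (begin
    x ^ suc π                            ≈⟨ +-identityʳ _ ⟨
    x ^ suc π + 0#                       ≈⟨ +-congˡ (trans (sym (×-zeroʳ p)) (×-congʳ p (sym cancel))) ⟩
    x ^ suc π + p × (x * q + x * - q)    ≈⟨ +-congˡ (×-distrib-+ _ _ p) ⟩
    x ^ suc π + (p × (x * q) + p × (x * - q)) ≈⟨ +-assoc _ _ _ ⟨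
    (x ^ suc π + p × (x * q)) + p × (x * - q) ≈⟨ +-congʳ vanish ⟩
    0# + p × (x * - q)                   ≈⟨ +-identityˡ _ ⟩
    p × (x * - q)                        ∎)
    where
    p = suc π
    cancel : x * q + x * - q ≈ 0#
    cancel = trans (sym (distribˡ x q (- q))) (trans (*-congˡ (-‿inverseʳ q)) (zeroʳ x))
    y = x ^ suc π + p × (x * q)
    vanish : y ≈ 0#
    vanish = begin
      y                 ≈⟨ +-identityˡ y ⟨
      0# + y            ≈⟨ +-congʳ (-‿inverseˡ 1#) ⟨
      (- 1# + 1#) + y   ≈⟨ +-assoc _ _ _ ⟩
      - 1# + (1# + y)   ≈⟨ +-congˡ (trans (sym e) unip) ⟩
      - 1# + 1#         ≈⟨ -‿inverseˡ 1# ⟩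
      0#                ∎

  -- Whenever the exponent of x reaches p, x^p is traded for p x q.
  reduce-power : ∀ π {x} → PowerRule (suc (suc π)) x → ∀ t → ∃₂ λ e j → ∃ λ z →
                 t ≡ e ℕ.* suc π ℕ.+ j ∧ j ≤ suc π ∧ x ^ t ≈ (suc (suc π) ℕ.^ e) × (x ^ j * z)
  reduce-power π rule zero = 0 , 0 , 1# , ≡.refl , z≤n , sym (trans (×-homo-1 _) (*-identityʳ 1#))
  reduce-power π {x} rule@(q , x^p≈) (suc t) with reduce-power π rule t
  ... | e , j , z , t≡ , j≤ , x^t≈ with ℕₚ.m≤n⇒m<n∨m≡n j≤
  ...   | inj₁ j< = e , suc j , z , ≡.trans (cong suc t≡) (≡.sym (ℕₚ.+-suc _ j)) , j< , (begin
    x * x ^ t                   ≈⟨ *-congˡ x^t≈ ⟩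
    x * ((p ℕ.^ e) × (x ^ j * z)) ≈⟨ ×-comm-* (p ℕ.^ e) x _ ⟩
    (p ℕ.^ e) × (x * (x ^ j * z)) ≈⟨ ×-congʳ (p ℕ.^ e) (*-assoc x (x ^ j) z) ⟨
    (p ℕ.^ e) × (x * x ^ j * z)   ∎)
    where p = suc (suc π)
  -- The remaining exponent was p - 1, so one more factor completes x^p. Trading it leaves a single
  -- x, hence the new exponent 1.
  ...   | inj₂ ≡.refl = suc e , 1 , q * z , ≡.trans (cong suc t≡) (lem e π) , s≤s z≤n , (begin
    x * x ^ t                          ≈⟨ *-congˡ x^t≈ ⟩
    x * ((p ℕ.^ e) × (x ^ suc π * z))  ≈⟨ ×-comm-* (p ℕ.^ e) x _ ⟩
    (p ℕ.^ e) × (x * (x ^ suc π * z))  ≈⟨ ×-congʳ (p ℕ.^ e)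
        (trans (sym (*-assoc x (x ^ suc π) z)) (*-congʳ x^p≈)) ⟩
    (p ℕ.^ e) × (p × (x * q) * z)      ≈⟨ ×-congʳ (p ℕ.^ e)
        (trans (×-assoc-* p (x * q) z) (×-congʳ p (trans (*-assoc x q z) (*-congʳ (sym (*-identityʳ x)))))) ⟩
    (p ℕ.^ e) × (p × (x ^ 1 * (q * z))) ≈⟨ ×-assocˡ _ (p ℕ.^ e) p ⟩
    (p ℕ.^ e ℕ.* p) × (x ^ 1 * (q * z)) ≈⟨ ×-congˡ (ℕₚ.*-comm (p ℕ.^ e) p) ⟩
    (p ℕ.^ suc e) × (x ^ 1 * (q * z)) ∎)
    where
    p = suc (suc π)
    lem : ∀ e π → suc (e ℕ.* suc π ℕ.+ suc π) ≡ suc e ℕ.* suc π ℕ.+ 1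
    lem = ℕ-Solver.solve-∀

  -- The exponent that `reduce-power` cannot trade is at most p - 1, which becomes the offset.
  Val-power : ∀ π {x} → PowerRule (suc (suc π)) x → ∀ t → Val (suc (suc π)) (suc π) (suc π) t (x ^ t)
  Val-power π rule t with reduce-power π rule t
  ... | e , j , z , t≡ , j≤ , x^t≈ = e ,
    ℕₚ.≤-trans (ℕₚ.≤-reflexive (≡.trans t≡ (ℕₚ.+-comm _ j)))
        (ℕₚ.+-mono-≤ j≤ (ℕₚ.≤-reflexive (ℕₚ.*-comm e (suc π)))) ,
    _ , x^t≈

  word : ∀ {s} → (Fin s → Carrier) → List (Fin s) → Carrier
  word x []       = 1#
  word x (i ∷ is) = x i * word x is

  word-split : ∀ {s} (x : Fin (suc s) → Carrier) is → ∃₂ λ c js →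
               length is ≡ c ℕ.+ length js ∧ word x is ≈ x zero ^ c * word (λ i → x (suc i)) js
  word-split x [] = 0 , [] , ≡.refl , sym (*-identityˡ 1#)
  word-split x (i ∷ is) with word-split x is
  word-split x (zero  ∷ is) | c , js , l , e = suc c , js , cong suc l , trans (*-congˡ e) (sym (*-assoc _ _ _))
  word-split x (suc i ∷ is) | c , js , l , e = c , i ∷ js , ≡.trans (cong suc l) (≡.sym (ℕₚ.+-suc c _)) ,
    trans (*-congˡ e) (x*yz≈y*xz _ _ _)

  -- `word-split` sorts the product by index. Each of the s indices brings the offset p - 1 of
  -- `Val-power`, and equal slopes let the bounds multiply.
  Val-word : ∀ π {s} (x : Fin s → Carrier) → (∀ i → PowerRule (suc (suc π)) (x i)) → ∀ is →
             Val (suc (suc π)) (s ℕ.* suc π) (suc π) (length is) (word x is)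
  Val-word π {zero}  x rule []       = Val-0 (suc (suc π)) 0 (suc π)
  Val-word π {suc s} x rule is with word-split x is
  ... | c , js , l , e = resp (sym e) (≡.subst (λ t → Val p (suc s ℕ.* suc π) (suc π) t
      (x zero ^ c * word (λ i → x (suc i)) js)) (≡.sym l)
    (Val-* p (suc π) (s ℕ.* suc π) (suc π) (Val-power π (rule zero) c)
        (Val-word π (λ i → x (suc i)) (λ i → rule (suc i)) js)))
    where
    p = suc (suc π)
    open IsFiltration (Val-filtration p (suc s ℕ.* suc π) π)

  Val-Pow : ∀ π {s} (x : Fin s → Carrier) → (∀ i → PowerRule (suc (suc π)) (x i)) →
            ∀ {k r} → AdicPowers.Pow R x k r → Val (suc (suc π)) (s ℕ.* suc π) (suc π) k r
  Val-Pow π {s} x rule pow = resp (*-identityˡ _) (go pow [])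
    where
    open IsFiltration (Val-filtration (suc (suc π)) (s ℕ.* suc π) π)
    open AdicPowers R x using (Pow; any; nil; sum; gen; ≈-resp)
    V = Val (suc (suc π)) (s ℕ.* suc π) (suc π)
    -- The generators already stripped from the derivation are collected in the word, so in the end
    -- only products of generators need a valuation.
    go : ∀ {k r} → Pow k r → ∀ is → V (length is ℕ.+ k) (word x is * r)
    go (any {r}) is = ≡.subst (λ t → V t (word x is * r)) (≡.sym (ℕₚ.+-identityʳ (length is)))
      (resp (*-comm r _) (Val-*ˡ (suc (suc π)) (s ℕ.* suc π) (suc π) r (Val-word π x rule is)))
    go nil is = resp (sym (zeroʳ _)) zero∈
    go (sum p q) is = resp (sym (distribˡ _ _ _)) (add (go p is) (go q is))
    go (gen {k} {r} i p) is = ≡.subst (λ t → V t (word x is * (x i * r))) (≡.sym (ℕₚ.+-suc (length is) k))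
      (resp (trans (*-assoc _ _ _) (x*yz≈y*xz _ _ _)) (go p (i ∷ is)))
    go (≈-resp e p) is = resp (*-congˡ e) (go p is)

open ≡ using (refl; sym; trans)

ℤ-ring : CommutativeRing 0ℓ 0ℓ
ℤ-ring = ℤₚ.+-*-commutativeRing

-- Finite sums and the group ring

∑ : {X : Set} → List X → (X → ℤ) → ℤ
∑ []       g = 0ℤ
∑ (x ∷ xs) g = g x ℤ.+ ∑ xs g

module _ {X : Set} where
  ∑-cong : ∀ (xs : List X) {g h} → (∀ x → g x ≡ h x) → ∑ xs g ≡ ∑ xs h
  ∑-cong []       g≗h = refl
  ∑-cong (x ∷ xs) g≗h = cong₂ ℤ._+_ (g≗h x) (∑-cong xs g≗h)

  ∑-++ : ∀ (xs ys : List X) g → ∑ (xs ++ ys) g ≡ ∑ xs g ℤ.+ ∑ ys g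
  ∑-++ []       ys g = sym (ℤₚ.+-identityˡ _)
  ∑-++ (x ∷ xs) ys g = trans (cong (ℤ._+_ (g x)) (∑-++ xs ys g)) (sym (ℤₚ.+-assoc (g x) _ _))

  ∑-↭ : ∀ {xs ys : List X} g → xs ↭ ys → ∑ xs g ≡ ∑ ys g
  ∑-↭ g Perm.refl         = refl
  ∑-↭ g (Perm.prep x p)   = cong (ℤ._+_ (g x)) (∑-↭ g p)
  ∑-↭ g (Perm.swap {xs} {ys} x y p) = trans (cong (λ z → g x ℤ.+ (g y ℤ.+ z)) (∑-↭ g p))
      (lem (g x) (g y) (∑ ys g))
    where
    lem : ∀ a b c → a ℤ.+ (b ℤ.+ c) ≡ b ℤ.+ (a ℤ.+ c)
    lem = solve-∀
  ∑-↭ g (Perm.trans p q)  = trans (∑-↭ g p) (∑-↭ g q)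

  ∑-map : ∀ {Z : Set} (φ : Z → X) zs g → ∑ (map φ zs) g ≡ ∑ zs (λ z → g (φ z))
  ∑-map φ []       g = refl
  ∑-map φ (z ∷ zs) g = cong (ℤ._+_ (g (φ z))) (∑-map φ zs g)

  ∑-concatMap : ∀ {Z : Set} (φ : Z → List X) zs g → ∑ (concatMap φ zs) g ≡ ∑ zs (λ z → ∑ (φ z) g)
  ∑-concatMap φ []       g = refl
  ∑-concatMap φ (z ∷ zs) g = trans (∑-++ (φ z) _ g) (cong (ℤ._+_ (∑ (φ z) g)) (∑-concatMap φ zs g))

module GroupRing {A : Set} {_∙_ : A → A → A} {ε : A} {_⁻¹ : A → A}
                 (isAbelianGroup : IsAbelianGroup _≡_ _∙_ ε _⁻¹) where
  open IsAbelianGroup isAbelianGroup using () renaming (assoc to ∙-assoc; comm to ∙-comm; identityˡ to ∙-identityˡ)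

  ℤ[A] : Set
  ℤ[A] = List (ℤ ∧ A)

  ev : ℤ[A] → (A → ℤ) → ℤ
  ev []            g = 0ℤ
  ev ((c , a) ∷ r) g = c ℤ.* g a ℤ.+ ev r g

  ev-cong : ∀ r {g h} → (∀ a → g a ≡ h a) → ev r g ≡ ev r h
  ev-cong []            g≗h = refl
  ev-cong ((c , a) ∷ r) g≗h = cong₂ (λ x y → c ℤ.* x ℤ.+ y) (g≗h a) (ev-cong r g≗h)

  ev-zero : ∀ r → ev r (λ _ → 0ℤ) ≡ 0ℤ
  ev-zero []            = refl
  ev-zero ((c , a) ∷ r) = cong₂ ℤ._+_ (ℤₚ.*-zeroʳ c) (ev-zero r)

  ev-+ : ∀ r g h → ev r (λ a → g a ℤ.+ h a) ≡ ev r g ℤ.+ ev r h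
  ev-+ []            g h = refl
  ev-+ ((c , a) ∷ r) g h =
    trans (cong (λ z → c ℤ.* (g a ℤ.+ h a) ℤ.+ z) (ev-+ r g h)) (lem c (g a) (h a) (ev r g) (ev r h))
    where
    lem : ∀ c x y z w → c ℤ.* (x ℤ.+ y) ℤ.+ (z ℤ.+ w) ≡ (c ℤ.* x ℤ.+ z) ℤ.+ (c ℤ.* y ℤ.+ w)
    lem = solve-∀

  ev-*ˡ : ∀ r c g → ev r (λ a → c ℤ.* g a) ≡ c ℤ.* ev r g
  ev-*ˡ []            c g = sym (ℤₚ.*-zeroʳ c)
  ev-*ˡ ((d , a) ∷ r) c g = trans (cong (λ z → d ℤ.* (c ℤ.* g a) ℤ.+ z) (ev-*ˡ r c g)) (lem c d (g a) (ev r g))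
    where
    lem : ∀ c d x y → d ℤ.* (c ℤ.* x) ℤ.+ c ℤ.* y ≡ c ℤ.* (d ℤ.* x ℤ.+ y)
    lem = solve-∀

  infix 4 _≈_
  -- Formal sums are identified when every integer-valued test function agrees on them. The ring
  -- laws thus reduce to identities of iterated sums, and evaluation respects equality by
  -- definition.
  record _≈_ (r r′ : ℤ[A]) : Set where
    constructor mk≈
    field ev-≡ : ∀ g → ev r g ≡ ev r′ g
  open _≈_ public

  [_] : A → ℤ[A]
  [ a ] = (1ℤ , a) ∷ []

  ev-[] : ∀ a g → ev [ a ] g ≡ g a
  ev-[] a g = trans (ℤₚ.+-identityʳ _) (ℤₚ.*-identityˡ (g a))

  neg : ℤ[A] → ℤ[A]
  neg = map (λ t → ℤ.- proj₁ t , proj₂ t)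

  ev-neg : ∀ r g → ev (neg r) g ≡ ℤ.- ev r g
  ev-neg []            g = refl
  ev-neg ((c , a) ∷ r) g = trans (cong (λ z → ℤ.- c ℤ.* g a ℤ.+ z) (ev-neg r g)) (lem c (g a) (ev r g))
    where
    lem : ∀ c x y → ℤ.- c ℤ.* x ℤ.+ ℤ.- y ≡ ℤ.- (c ℤ.* x ℤ.+ y)
    lem = solve-∀

  ev-++ : ∀ r r′ g → ev (r ++ r′) g ≡ ev r g ℤ.+ ev r′ g
  ev-++ []            r′ g = sym (ℤₚ.+-identityˡ (ev r′ g))
  ev-++ ((c , a) ∷ r) r′ g = trans (cong (λ z → c ℤ.* g a ℤ.+ z) (ev-++ r r′ g))
      (sym (ℤₚ.+-assoc (c ℤ.* g a) (ev r g) (ev r′ g)))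

  scale : ℤ ∧ A → ℤ[A] → ℤ[A]
  scale (c , a) = map (λ t → c ℤ.* proj₁ t , a ∙ proj₂ t)

  mul : ℤ[A] → ℤ[A] → ℤ[A]
  mul r r′ = concatMap (λ t → scale t r′) r

  ev-scale : ∀ c a r g → ev (scale (c , a) r) g ≡ c ℤ.* ev r (λ b → g (a ∙ b))
  ev-scale c a []            g = sym (ℤₚ.*-zeroʳ c)
  ev-scale c a ((d , b) ∷ r) g =
    trans (cong (λ z → c ℤ.* d ℤ.* g (a ∙ b) ℤ.+ z) (ev-scale c a r g))
        (lem c d (g (a ∙ b)) (ev r (λ b → g (a ∙ b))))
    where
    lem : ∀ c d x y → c ℤ.* d ℤ.* x ℤ.+ c ℤ.* y ≡ c ℤ.* (d ℤ.* x ℤ.+ y)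
    lem = solve-∀

  ev-mul : ∀ r r′ g → ev (mul r r′) g ≡ ev r (λ a → ev r′ (λ b → g (a ∙ b)))
  ev-mul []            r′ g = refl
  ev-mul ((c , a) ∷ r) r′ g =
    trans (ev-++ (scale (c , a) r′) (mul r r′) g) (cong₂ ℤ._+_ (ev-scale c a r′ g) (ev-mul r r′ g))

  ev-swap : ∀ r r′ (g : A → A → ℤ) → ev r (λ a → ev r′ (g a)) ≡ ev r′ (λ b → ev r (λ a → g a b))
  ev-swap []            r′ g = sym (ev-zero r′)
  ev-swap ((c , a) ∷ r) r′ g = trans
    (cong₂ ℤ._+_ (sym (ev-*ˡ r′ c (g a))) (ev-swap r r′ g))
    (sym (ev-+ r′ (λ b → c ℤ.* g a b) (λ b → ev r (λ a → g a b))))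

  mul-comm : ∀ r r′ → mul r r′ ≈ mul r′ r
  mul-comm r r′ = mk≈ λ g → trans (ev-mul r r′ g) (trans (ev-swap r r′ _)
    (trans (ev-cong r′ (λ b → ev-cong r (λ a → cong g (∙-comm a b)))) (sym (ev-mul r′ r g))))

  mul-cong : ∀ {q q′ r r′} → q ≈ q′ → r ≈ r′ → mul q r ≈ mul q′ r′
  mul-cong {q} {q′} {r} {r′} q≈ r≈ = mk≈ λ g → trans (ev-mul q r g)
    (trans (ev-cong q (λ a → ev-≡ r≈ _)) (trans (ev-≡ q≈ _) (sym (ev-mul q′ r′ g))))

  mul-assoc : ∀ q r t → mul (mul q r) t ≈ mul q (mul r t)
  mul-assoc q r t = mk≈ λ g → trans (ev-mul (mul q r) t g) (trans (ev-mul q r _)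
    (trans (ev-cong q (λ a → trans (ev-cong r (λ b → ev-cong t (λ c → cong g (∙-assoc a b c))))
        (sym (ev-mul r t _))))
      (sym (ev-mul q (mul r t) g))))

  mul-identityˡ : ∀ r → mul [ ε ] r ≈ r
  mul-identityˡ r = mk≈ λ g → trans (ev-mul [ ε ] r g)
      (trans (ev-[] ε (λ a → ev r (λ b → g (a ∙ b)))) (ev-cong r (λ a → cong g (∙-identityˡ a))))

  mul-distribˡ : ∀ q r t → mul q (r ++ t) ≈ mul q r ++ mul q t
  mul-distribˡ q r t = mk≈ λ g → trans (ev-mul q (r ++ t) g)
    (trans (ev-cong q (λ a → ev-++ r t _)) (trans (ev-+ q _ _)
      (trans (cong₂ ℤ._+_ (sym (ev-mul q r g)) (sym (ev-mul q t g))) (sym (ev-++ (mul q r) _ g)))))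

  ≈-trans : ∀ {q r t} → q ≈ r → r ≈ t → q ≈ t
  ≈-trans p q = mk≈ λ g → trans (ev-≡ p g) (ev-≡ q g)

  ++-cong : ∀ {q q′ r r′} → q ≈ q′ → r ≈ r′ → q ++ r ≈ q′ ++ r′
  ++-cong {q} {q′} {r} {r′} p p′ = mk≈ λ g → trans (ev-++ q r g)
      (trans (cong₂ ℤ._+_ (ev-≡ p g) (ev-≡ p′ g)) (sym (ev-++ q′ r′ g)))

  ++-comm : ∀ r t → r ++ t ≈ t ++ r
  ++-comm r t = mk≈ λ g → trans (ev-++ r t g) (trans (ℤₚ.+-comm (ev r g) _) (sym (ev-++ t r g)))

  ++-inverseˡ : ∀ r → neg r ++ r ≈ []
  ++-inverseˡ r = mk≈ λ g → trans (ev-++ (neg r) r g)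
      (trans (cong (ℤ._+ ev r g) (ev-neg r g)) (ℤₚ.+-inverseˡ (ev r g)))

  ℤ[A]-isCommutativeRing : IsCommutativeRing _≈_ _++_ mul neg [] [ ε ]
  ℤ[A]-isCommutativeRing = record
    { isRing = record
      { +-isAbelianGroup = record
        { isGroup = record
          { isMonoid = record
            { isSemigroup = record
              { isMagma = record
                { isEquivalence = record
                  { refl = mk≈ λ g → refl ; sym = λ p → mk≈ λ g → sym (ev-≡ p g) ; trans = ≈-trans }
                ; ∙-cong = ++-cong }
              ; assoc = λ q r t → mk≈ λ g → trans (ev-++ (q ++ r) t g) (trans (cong (ℤ._+ ev t g) (ev-++ q r g))
                  (trans (ℤₚ.+-assoc (ev q g) _ _)
                      (trans (cong (λ z → ev q g ℤ.+ z) (sym (ev-++ r t g))) (sym (ev-++ q (r ++ t) g))))) }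
            ; identity = (λ r → mk≈ λ g → refl) , (λ r → ++-comm r []) }
          ; inverse = ++-inverseˡ , (λ r → ≈-trans (++-comm r (neg r)) (++-inverseˡ r))
          ; ⁻¹-cong = λ {r} {t} p → mk≈ λ g → trans (ev-neg r g)
              (trans (cong ℤ.-_ (ev-≡ p g)) (sym (ev-neg t g))) }
        ; comm = ++-comm }
      ; *-cong = mul-cong
      ; *-assoc = mul-assoc
      ; *-identity = mul-identityˡ , (λ r → ≈-trans (mul-comm r _) (mul-identityˡ r))
      ; distrib = mul-distribˡ , (λ t q r → ≈-trans (mul-comm (q ++ r) t)
          (≈-trans (mul-distribˡ t q r) (++-cong (mul-comm t q) (mul-comm t r)))) }
    ; *-comm = mul-comm }

  commutativeRing : CommutativeRing 0ℓ 0ℓ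
  commutativeRing = record { isCommutativeRing = ℤ[A]-isCommutativeRing }

  [∙]-homo : ∀ a b → [ a ∙ b ] ≈ mul [ a ] [ b ]
  [∙]-homo a b = mk≈ λ g → trans (ev-[] (a ∙ b) g)
      (sym (trans (ev-mul [ a ] [ b ] g) (trans (ev-[] a (λ a → ev [ b ] (λ b → g (a ∙ b))))
          (ev-[] b (λ b → g (a ∙ b))))))

Δ-∑ : ∀ {X Y M : Set} (act : M → Y → Y) ms (xs : List X) (g : X → Y → ℤ) y →
      let open Differences ℤ-ring act in
      Δ ms (λ z → ∑ xs (λ x → g x z)) y ≡ ∑ xs (λ x → Δ ms (g x) y)
Δ-∑ act ms []       g y = Differences.Δ-zero ℤ-ring act ms (λ _ → refl) y
Δ-∑ act ms (x ∷ xs) g y = trans (Differences.Δ-+ ℤ-ring act ms (g x) (λ z → ∑ xs (λ x → g x z)) y)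
  (cong (ℤ._+_ (Differences.Δ ℤ-ring act ms (g x) y)) (Δ-∑ act ms xs g y))

-- Functional degree and composition

module Degree (R : CommutativeRing 0ℓ 0ℓ) {Y M : Set} (act : M → Y → Y) where
  open CommutativeRing R hiding (zero) renaming (refl to ≈-refl; sym to ≈-sym; trans to ≈-trans)
  open Differences R act

  -- Written as a family so that degree becomes an instance of `Prof`; sums and products of
  -- functions then obey the general rules for profiles.
  Vanish : ℕ → Family
  Vanish w t x = w < t → x ≈ 0#

  Vanish-filtration : ∀ w → IsFiltration (Vanish w)
  Vanish-filtration w = record
    { isAdditive = record
      { resp  = λ x≈y v w<t → ≈-trans (≈-sym x≈y) (v w<t)
      ; zero∈ = λ _ → ≈-refl
      ; add   = λ v v′ w<t → ≈-trans (+-cong (v w<t) (v′ w<t)) (+-identityˡ 0#) }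
    ; anti = λ v w<t → v (ℕₚ.m<n⇒m<1+n w<t) }

  Deg : ℕ → (Y → Carrier) → Set
  Deg w = Prof (Vanish w)

  Deg-cong : ∀ {w u v} → (∀ y → u y ≈ v y) → Deg w u → Deg w v
  Deg-cong {w} = Prof-cong (IsFiltration.isAdditive (Vanish-filtration w))

  Deg-mono : ∀ {w w′ u} → w ≤ w′ → Deg w u → Deg w′ u
  Deg-mono w≤w′ du ms y w′<t = du ms y (ℕₚ.≤-<-trans w≤w′ w′<t)

  Deg-+ : ∀ {w u v} → Deg w u → Deg w v → Deg w (λ y → u y + v y)
  Deg-+ {w} = Prof-+ (IsFiltration.isAdditive (Vanish-filtration w))

  Deg-* : ∀ {w w′ u v} → Deg w u → Deg w′ v → Deg (w ℕ.+ w′) (λ y → u y * v y)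
  Deg-* {w} {w′} = Prof-* {Vanish w} {Vanish w′} {Vanish (w ℕ.+ w′)}
    (Vanish-filtration w′) (IsFiltration.isAdditive (Vanish-filtration (w ℕ.+ w′))) mul
    where
    mul : Multiplies (Vanish w) (Vanish w′) (Vanish (w ℕ.+ w′))
    mul {a} {b} {x} {y} va vb lt with w ℕₚ.<? a
    ... | yes w<a = ≈-trans (*-congʳ (va w<a)) (zeroˡ y)
    ... | no  w≮a = ≈-trans (*-congˡ (vb (ℕₚ.+-cancelˡ-< w w′ b
        (ℕₚ.<-≤-trans lt (ℕₚ.+-monoˡ-≤ b (ℕₚ.≮⇒≥ w≮a)))))) (zeroʳ x)

  Invariant : (Y → Carrier) → Set
  Invariant u = ∀ m y → u (act m y) ≈ u y

  Affine : (Y → Carrier) → Set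
  Affine u = ∀ m → ∃ λ h → ∀ y → u (act m y) ≈ h + u y

  Deg-invariant : ∀ {u} → Invariant u → Deg 0 u
  Deg-invariant inv []       y ()
  Deg-invariant inv (m ∷ ms) y _ = Δ-invariant m ms inv y

  Deg0⇒Invariant : ∀ {u} → Deg 0 u → Invariant u
  Deg0⇒Invariant {u} deg m y = ≈-trans (≈-sym (+-identityʳ _)) (≈-trans (+-congˡ (≈-sym (-‿inverseˡ (u y))))
    (≈-trans (≈-sym (+-assoc _ _ _)) (≈-trans (+-congʳ (deg (m ∷ []) y (s≤s z≤n))) (+-identityˡ _))))

  Deg-affine : ∀ {u} → Affine u → Deg 1 u
  Deg-affine aff []            y ()
  Deg-affine aff (m ∷ [])      y (s≤s ())
  Deg-affine {u} aff (m ∷ m′ ∷ ms) y _ = Δ-invariant m′ ms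
      (λ m″ z → ≈-trans (slope (act m″ z)) (≈-sym (slope z))) y
    where
    slope : ∀ z → ∂ m u z ≈ proj₁ (aff m)
    slope z = ≈-trans (+-congʳ (proj₂ (aff m) z)) (≈-trans (+-assoc _ _ _)
      (≈-trans (+-congˡ (-‿inverseʳ (u z))) (+-identityʳ _)))

≡-ring : {A : Set} {_+_ _*_ : A → A → A} { -_ : A → A} {0# 1# : A} →
         IsCommutativeRing _≡_ _+_ _*_ -_ 0# 1# → CommutativeRing 0ℓ 0ℓ
≡-ring isCommutativeRing = record { isCommutativeRing = isCommutativeRing }

module Exponential {A : Set} {_+_ _*_ : A → A → A} { -_ : A → A} {0# 1# : A}
         (A-isCommutativeRing : IsCommutativeRing _≡_ _+_ _*_ -_ 0# 1#)
         (R-ring : CommutativeRing 0ℓ 0ℓ) (exp : A → CommutativeRing.Carrier R-ring)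
         (exp-homo : ∀ a b → CommutativeRing._≈_ R-ring (exp (a + b))
             (CommutativeRing._*_ R-ring (exp a) (exp b))) where

  A-ring : CommutativeRing 0ℓ 0ℓ
  A-ring = ≡-ring A-isCommutativeRing

  module A = CommutativeRing A-ring
  module R = CommutativeRing R-ring
  open RingProperties R.ring using (-‿distribʳ-*; -‿+-comm)
  open CommutativeSemigroupProperties R.+-commutativeSemigroup using (interchange)
  open SetoidReasoning R.setoid

  X : A → R.Carrier
  X a = exp a R.- R.1#

  open AdicPowers R-ring X public

  module Composition {Y M : Set} (act : M → Y → Y) where
    module DA = Differences A-ring act
    module DR = Differences R-ring act
    open Filtrations R-ring

    open Degree A-ring act using (Deg; Deg0⇒Invariant)

    -- Level w t is the ideal I^⌈t/w⌉ for w > 0.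
    Level : ℕ → Family
    Level w = Graded (λ t k → t ≤ w ℕ.* k) Pow Pow-additive

    Level-filtration : ∀ w → IsFiltration (Level (suc w))
    Level-filtration w = Graded-filtration _ Pow Pow-additive
      (λ le → ℕₚ.≤-trans (ℕₚ.n≤1+n _) le) (λ t → t , ℕₚ.m≤m+n t (w ℕ.* t)) Pow-anti-≤

    ∂-exp : ∀ φ m y → DR.∂ m (λ z → exp (φ z)) y R.≈ exp (φ y) R.* X (DA.∂ m φ y)
    ∂-exp φ m y = begin
      exp (φ (act m y)) R.- exp (φ y)                               ≈⟨ R.+-congʳ {R.- exp (φ y)}
          (R.reflexive (cong exp split)) ⟩
      exp (φ y + DA.∂ m φ y) R.- exp (φ y)                          ≈⟨ R.+-cong (exp-homo (φ y) (DA.∂ m φ y))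
          (R.-‿cong (R.sym (R.*-identityʳ (exp (φ y))))) ⟩
      exp (φ y) R.* exp (DA.∂ m φ y) R.- exp (φ y) R.* R.1#
          ≈⟨ R.+-congˡ {exp (φ y) R.* exp (DA.∂ m φ y)} (-‿distribʳ-* (exp (φ y)) R.1#) ⟩
      exp (φ y) R.* exp (DA.∂ m φ y) R.+ exp (φ y) R.* (R.- R.1#)     ≈⟨ R.distribˡ (exp (φ y))
          (exp (DA.∂ m φ y)) (R.- R.1#) ⟨
      exp (φ y) R.* X (DA.∂ m φ y)                                ∎
      where
      split : φ (act m y) ≡ φ y + DA.∂ m φ y
      split = sym (trans (A.+-comm _ _) (trans (A.+-assoc _ _ _)
          (trans (cong (_ +_) (A.-‿inverseˡ (φ y))) (A.+-identityʳ _))))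

    -- Mutual induction on the degree: a difference of exp ∘ φ involves X ∘ ∂φ with ∂φ of one degree
    -- less, while differences of X ∘ φ are those of exp ∘ φ. The degree has the form w + 1 because
    -- an order t / 0 is meaningless; degree 0 is settled in `Prof-X` by invariance.
    Prof-exp : ∀ w {φ} → Deg (suc w) φ → DR.Prof (Level (suc w)) (λ y → exp (φ y))
    -- Measured with the slope w + 1 instead of w, a function of degree w leaves one order to spare,
    -- since X ∘ φ lies in the ideal before any difference is taken. That order pays for the
    -- difference already spent on ∂φ in `Prof-exp`.
    Prof-X   : ∀ w {φ} → Deg w φ → DR.Prof (shift (Level (suc w))) (λ y → X (φ y))

    Prof-exp w {φ} deg ms = truncated (length ms) ms ℕₚ.≤-refl
      where
      -- In the Leibniz rule for [φ] · ([∂φ] − 1) the claim for [φ] is only needed up to order T.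
      truncated : ∀ T ms → length ms ≤ T → ∀ y → Level (suc w) (length ms) (DR.Δ ms (λ z → exp (φ z)) y)
      truncated T       []       _         y = 0 , z≤n , any
      truncated (suc T) (m ∷ ms) (s≤s len) y = IsFiltration.resp (Level-filtration w)
        (R.sym (DR.Δ-cong ms (∂-exp φ m) y))
        (DR.Prof-* {U = λ t r → t ≤ T → Level (suc w) t r} {V = shift (Level (suc w))}
           {W = λ t r → t ≤ T → Level (suc w) (suc t) r}
           (shift-filtration (Level-filtration w))
           (record { resp = λ e p le → L.resp e (p le) ; zero∈ = λ _ → L.zero∈ ; add = λ p q le → L.add (p le)
               (q le) })
           multiplies (λ l z le → truncated T l le z)
           (Prof-X w {DA.∂ m φ} (λ l z w<t → deg (m ∷ l) z (s≤s w<t))) ms y len)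
        where
        module L = IsFiltration (Level-filtration w)
        multiplies : Multiplies (λ t r → t ≤ T → Level (suc w) t r) (shift (Level (suc w)))
                                (λ t r → t ≤ T → Level (suc w) (suc t) r)
        multiplies {a} {b} p (l , b<l , ql) le with p (ℕₚ.≤-trans (ℕₚ.m≤m+n a b) le)
        ... | k , a≤k , qk = k ℕ.+ l ,
          ℕₚ.≤-trans (ℕₚ.≤-reflexive (sym (ℕₚ.+-suc a b)))
            (ℕₚ.≤-trans (ℕₚ.+-mono-≤ a≤k b<l) (ℕₚ.≤-reflexive (sym (ℕₚ.*-distribˡ-+ (suc w) k l)))) ,
          Pow-* qk ql

    Prof-X w deg [] y = 1 , s≤s z≤n , Pow-X _
    Prof-X zero {φ} deg (m ∷ ms) y = suc (suc (length ms)) , ℕₚ.≤-reflexive (sym (ℕₚ.*-identityˡ _)) ,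
      ≈-resp (R.sym (DR.Δ-invariant m ms (λ m z → R.reflexive (cong X (Deg0⇒Invariant deg m z))) y)) nil
    Prof-X (suc w) {φ} deg (m ∷ ms) y with Prof-exp w deg (m ∷ ms) y
    -- At least one difference was taken, so the power k is positive; hence t ≤ (w + 1) k improves
    -- to t + 1 ≤ (w + 2) k.
    ... | zero  , t≤ , _ = ⊥-elim (ℕₚ.n≮0 (ℕₚ.≤-trans t≤ (ℕₚ.≤-reflexive (ℕₚ.*-zeroʳ w))))
    ... | suc k , t≤ , q = suc k , ℕₚ.+-mono-≤ (s≤s (z≤n {k})) t≤ ,
      ≈-resp (DR.Δ-cong ms (λ z → R.sym (cancel (act m z) z)) y) q
      where
      cancel : ∀ z′ z → X (φ z′) R.- X (φ z) R.≈ exp (φ z′) R.- exp (φ z)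
      cancel z′ z = R.trans (R.+-congˡ {X (φ z′)} (R.sym (-‿+-comm (exp (φ z)) (R.- R.1#))))
        (R.trans (interchange (exp (φ z′)) (R.- R.1#) (R.- exp (φ z)) (R.- (R.- R.1#)))
          (R.trans (R.+-congˡ {exp (φ z′) R.- exp (φ z)} (R.-‿inverseʳ (R.- R.1#))) (R.+-identityʳ _)))


module Evaluation {A : Set} {_+_ _*_ : A → A → A} { -_ : A → A} {0# 1# : A}
         (A-isCommutativeRing : IsCommutativeRing _≡_ _+_ _*_ -_ 0# 1#) where
  open GroupRing (IsCommutativeRing.+-isAbelianGroup A-isCommutativeRing) public
  open Exponential A-isCommutativeRing commutativeRing [_] [∙]-homo public
  open RingProperties R.ring using (-‿distribˡ-*)

  Δ-ev : ∀ {Y M : Set} (act : M → Y → Y) ms (u : Y → ℤ[A]) g y →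
         ev (Differences.Δ commutativeRing act ms u y) g ≡
         Differences.Δ ℤ-ring act ms (λ z → ev (u z) g) y
  Δ-ev act []       u g y = refl
  Δ-ev act (m ∷ ms) u g y = trans (Δ-ev act ms (Differences.∂ commutativeRing act m u) g y)
    (Differences.Δ-cong ℤ-ring act ms (λ z → trans (ev-++ (u (act m z)) (neg (u z)) g)
      (cong (ℤ._+_ (ev (u (act m z)) g)) (ev-neg (u z) g))) y)

  module T = Differences ℤ-ring (_+_)

  -- Multiplication by [a] - 1 is the transpose of the difference operator on test functions.
  ev-X : ∀ a r g → ev (X a R.* r) g ≡ ev r (T.∂ a g)
  ev-X a r g = trans (ev-≡ (R.distribʳ r [ a ] (R.- R.1#)) g)
      (trans (ev-++ ([ a ] R.* r) ((R.- R.1#) R.* r) g)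
        (trans (cong₂ ℤ._+_
            (trans (ev-mul [ a ] r g) (ev-[] a (λ b → ev r (λ c → g (b + c)))))
            (trans (ev-≡ (R.trans (R.sym (-‿distribˡ-* R.1# r)) (R.-‿cong (R.*-identityˡ r))) g)
              (trans (ev-neg r g) (trans (sym (ℤₚ.-1*i≡-i (ev r g))) (sym (ev-*ˡ r ℤ.-1ℤ g))))))
          (trans (sym (ev-+ r (λ c → g (a + c)) (λ c → ℤ.-1ℤ ℤ.* g c)))
            (ev-cong r (λ c → cong (ℤ._+_ (g (a + c))) (ℤₚ.-1*i≡-i (g c)))))))

  -- By `ev-X` each generator in the derivation turns into a difference of g, and shifting `V` keeps
  -- count of them.
  ev-Pow : ∀ {V : T.Family} → T.IsAdditive V → (∀ {t x} c → V t x → V t (c ℤ.* x)) →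
           ∀ {k r g} → Pow k r → T.Prof V g → V k (ev r g)
  ev-Pow {V} aV mulV (any {r}) pg = go r
    where
    go : ∀ r → V 0 (ev r _)
    go []            = T.IsAdditive.zero∈ aV
    go ((c , a) ∷ r) = T.IsAdditive.add aV (mulV c (pg [] a)) (go r)
  ev-Pow aV mulV nil        pg = T.IsAdditive.zero∈ aV
  ev-Pow {V} aV mulV {k} {g = g} (sum {_} {q} {r} p p′) pg = ≡.subst (V k) (sym (ev-++ q r g))
    (T.IsAdditive.add aV (ev-Pow aV mulV p pg) (ev-Pow aV mulV p′ pg))
  ev-Pow {V} aV mulV {k} {g = g} (gen {_} {r} a p) pg = ≡.subst (V k) (sym (ev-X a r g))
    (ev-Pow {T.shift V} (T.shift-additive aV) mulV p (λ l → pg (a ∷ l)))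
  ev-Pow {V} aV mulV {k} {g = g} (≈-resp e p) pg = ≡.subst (V k) (ev-≡ e g) (ev-Pow aV mulV p pg)

-- The augmentation ideal along a basis

module Combinations (R : CommutativeRing 0ℓ 0ℓ) where
  open CommutativeRing R using (Carrier; _+_; 0#)
  open RingLemmas R using (_×_)

  comb : ∀ {k} → Vec ℕ k → Vec Carrier k → Carrier
  comb []       []       = 0#
  comb (n ∷ ns) (e ∷ es) = (n × e) + comb ns es

  combFin : ∀ {p k} → Vec Carrier k → Vec (Fin p) k → Carrier
  combFin es cs = comb (Vec.map toℕ cs) es

module Unipotent {A : Set} {_+_ _*_ : A → A → A} { -_ : A → A} {0# 1# : A}
         (A-isCommutativeRing : IsCommutativeRing _≡_ _+_ _*_ -_ 0# 1#)
         (R-ring : CommutativeRing 0ℓ 0ℓ) (exp : A → CommutativeRing.Carrier R-ring)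
         (exp-homo : ∀ a b → CommutativeRing._≈_ R-ring (exp (a + b))
             (CommutativeRing._*_ R-ring (exp a) (exp b)))
         (exp-0 : CommutativeRing._≈_ R-ring (exp 0#) (CommutativeRing.1# R-ring)) where
  open Exponential A-isCommutativeRing R-ring exp exp-homo
  open Combinations A-ring
  open RingLemmas A-ring using (_×_)
  private module ×R = RingLemmas R-ring
  open ×R using (_^_; geom; PowerRule; Val)

  exp-× : ∀ n a → exp (n × a) R.≈ exp a ^ n
  exp-× zero    a = exp-0
  exp-× (suc n) a = R.trans (exp-homo a (n × a)) (R.*-congˡ (exp-× n a))

  1+X : ∀ a → R.1# R.+ X a R.≈ exp a
  1+X a = R.trans (R.+-comm _ _) (R.trans (R.+-assoc _ _ _)
      (R.trans (R.+-congˡ (R.-‿inverseˡ R.1#)) (R.+-identityʳ (exp a))))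

  X-0 : X 0# R.≈ R.0#
  X-0 = R.trans (R.+-congʳ exp-0) (R.-‿inverseʳ R.1#)

  X-+ : ∀ a b → X (a + b) R.≈ X a R.* exp b R.+ X b
  X-+ a b = R.trans (R.+-congʳ (exp-homo a b)) (R.sym (R.trans
    (R.+-congʳ (R.trans (R.distribʳ (exp b) (exp a) (R.- R.1#))
       (R.+-congˡ (R.trans (R.sym (-‿distribˡ-* R.1# (exp b))) (R.-‿cong (R.*-identityˡ (exp b)))))))
    (R.trans (R.+-assoc _ _ _) (R.+-congˡ (R.trans (R.sym (R.+-assoc _ _ _))
       (R.trans (R.+-congʳ (R.-‿inverseˡ (exp b))) (R.+-identityˡ _)))))))
    where
    open import Algebra.Properties.Ring R.ring using (-‿distribˡ-*)

  module _ {π : ℕ} (prime : Prime (suc (suc π))) (char : ∀ a → suc (suc π) × a ≡ 0#) where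
    private
      p : ℕ
      p = suc (suc π)

    -- 1 + X a is exp a, whose p-th power is exp (p × a) = exp 0 = 1.
    X-PowerRule : ∀ a → PowerRule p (X a)
    X-PowerRule a = ×R.unipotent⇒PowerRule prime (X a)
      (R.trans (×R.^-congˡ p (1+X a)) (R.trans (R.sym (exp-× p a))
          (R.trans (R.reflexive (cong exp (char a))) exp-0)))

    X^k∈Pow : ∀ a k → Pow k (X a ^ k)
    X^k∈Pow a zero    = any
    X^k∈Pow a (suc k) = gen a (X^k∈Pow a k)

    geom-exp : ∀ a → ∃ λ q → geom (exp a) p R.≈ X a ^ suc π R.+ p ×R.× q
    geom-exp a = proj₁ g , R.trans (geom-cong p) (proj₂ g)
      where
      g = ×R.geom-mod-prime prime (X a)
      geom-cong : ∀ n → geom (exp a) n R.≈ geom (R.1# R.+ X a) n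
      geom-cong zero    = R.refl
      geom-cong (suc n) = R.+-congˡ (R.*-cong (R.sym (1+X a)) (geom-cong n))

    module _ {s : ℕ} (es : Vec A s) (spanning : ∀ a → ∃ λ ns → a ≡ comb ns es) where
      private
        module P = AdicPowers R-ring (λ i → X (lookup es i))

      -- By `X-+` the elements a for which X a lies in a given ideal are closed under addition.
      X-comb : ∀ {k} (ns : Vec ℕ k) (ds : Vec A k) → (∀ i → P.Pow 1 (X (lookup ds i))) → P.Pow 1
          (X (comb ns ds))
      X-comb []       []       gens = P.≈-resp (R.sym X-0) P.nil
      X-comb (n ∷ ns) (d ∷ ds) gens = closed (multiple n) (X-comb ns ds (λ i → gens (suc i)))
        where
        closed : ∀ {a b} → P.Pow 1 (X a) → P.Pow 1 (X b) → P.Pow 1 (X (a + b))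
        closed {a} {b} pa pb = P.≈-resp (R.sym (X-+ a b)) (P.sum (P.Pow-*ʳ (exp b) pa) pb)
        multiple : ∀ n → P.Pow 1 (X (n × d))
        multiple zero    = P.≈-resp (R.sym X-0) P.nil
        multiple (suc n) = closed (gens zero) (multiple n)

      -- The offset in `Val-Pow` counts generators. Passing from all field elements to a basis
      -- brings their number down to s.
      Pow⇒generated : ∀ {k r} → Pow k r → P.Pow k r
      Pow⇒generated any = P.any
      Pow⇒generated nil = P.nil
      Pow⇒generated (sum q r) = P.sum (Pow⇒generated q) (Pow⇒generated r)
      Pow⇒generated (gen a q) = P.Pow-* (≡.subst (λ z → P.Pow 1 (X z)) (sym (proj₂ (spanning a)))
        (X-comb (proj₁ (spanning a)) es P.Pow-X)) (Pow⇒generated q)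
      Pow⇒generated (≈-resp e q) = P.≈-resp e (Pow⇒generated q)

      Pow⇒Val : ∀ {k r} → Pow k r → Val p (s ℕ.* suc π) (suc π) k r
      Pow⇒Val q = ×R.Val-Pow π (λ i → X (lookup es i)) (λ i → X-PowerRule (lookup es i)) (Pow⇒generated q)

-- Sums over spans as iterated differences

∑-cartesianProductWith : ∀ {A B C : Set} (f : A → B → C) xs ys g →
  ∑ (cartesianProductWith f xs ys) g ≡ ∑ xs (λ x → ∑ ys (λ y → g (f x y)))
∑-cartesianProductWith f []       ys g = refl
∑-cartesianProductWith f (x ∷ xs) ys g = trans (∑-++ (map (f x) ys) (cartesianProductWith f xs ys) g)
  (cong₂ ℤ._+_ (∑-map (f x) ys g) (∑-cartesianProductWith f xs ys g))

∑-allFin : ∀ n (h : ℕ → ℤ) → ∑ (allFin (suc n)) (λ c → h (toℕ c)) ≡ h 0 ℤ.+ ∑ (allFin n) (λ c → h (suc (toℕ c)))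
∑-allFin n h = cong (ℤ._+_ (h 0)) (trans (cong (λ l → ∑ l (λ c → h (toℕ c)))
    (sym (Listₚ.map-tabulate {n = n} (λ i → i) Fin.suc)))
  (∑-map Fin.suc (allFin n) (λ c → h (toℕ c))))

-- The head coefficient varies fastest, so that the inner sum in `∑-span` runs over the multiples of
-- the first vector.
coefficients : (p k : ℕ) → List (Vec (Fin p) k)
coefficients p zero    = [] ∷ []
coefficients p (suc k) = cartesianProductWith (λ cs c → c ∷ cs) (coefficients p k) (allFin p)

module Summation {A : Set} {_+_ _*_ : A → A → A} { -_ : A → A} {0# 1# : A}
         (A-isCommutativeRing : IsCommutativeRing _≡_ _+_ _*_ -_ 0# 1#)
         {π : ℕ} (prime : Prime (suc (suc π)))
         (char : ∀ a → RingLemmas._×_ (≡-ring A-isCommutativeRing) (suc (suc π)) a ≡ 0#) where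
  open Evaluation A-isCommutativeRing
  open Unipotent A-isCommutativeRing commutativeRing [_] [∙]-homo R.refl
  open Combinations A-ring
  open RingLemmas A-ring using (_×_)
  private
    module ×R = RingLemmas commutativeRing
    module ×ℤ = RingLemmas ℤ-ring
    p : ℕ
    p = suc (suc π)

  ev-× : ∀ n r g → ev (n ×R.× r) g ≡ n ×ℤ.× ev r g
  ev-× zero    r g = refl
  ev-× (suc n) r g = trans (ev-++ r (n ×R.× r) g) (cong (ℤ._+_ (ev r g)) (ev-× n r g))

  ev-geom : ∀ e n g → ev (×R.geom [ e ] n) g ≡ ∑ (allFin n) (λ c → g (toℕ c × e))
  ev-geom e zero    g = refl
  ev-geom e (suc n) g = trans (ev-++ R.1# ([ e ] R.* ×R.geom [ e ] n) g)
    (trans (cong₂ ℤ._+_ (ev-[] 0# g)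
        (trans (ev-mul [ e ] (×R.geom [ e ] n) g)
          (trans (ev-[] e (λ a → ev (×R.geom [ e ] n) (λ b → g (a + b)))) (ev-geom e n (λ b → g (e + b))))))
      (sym (∑-allFin n (λ c → g (c × e)))))

  -- In `p-step` a factor p is credited with p - 1 differences, the rate at which the two terms X^(p
  -- - 1) and p q of `geom-exp` have equal order.
  record IsSummable (V : T.Family) : Set where
    field
      additive : T.IsAdditive V
      *-closed : ∀ {t x} c → V t x → V t (c ℤ.* x)
      p-step   : ∀ {t x} → V t x → V (suc π ℕ.+ t) (p ×ℤ.× x)

  module _ {V : T.Family} (sV : IsSummable V) where
    open IsSummable sV
    open T.IsAdditive additive

    -- The sum is the value at g of the geometric sum of [e]. In `geom-exp` the power of X takes p -
    -- 1 differences of g, and `p-step` gives the remainder the same order.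
    ∑-multiples : ∀ e {g} → T.Prof V g → V (suc π) (∑ (allFin p) (λ c → g (toℕ c × e)))
    ∑-multiples e {g} pg = ≡.subst (V (suc π)) eq
      (add (ev-Pow additive *-closed (X^k∈Pow prime char e (suc π)) pg)
           (≡.subst (λ t → V t (p ×ℤ.× ev q g)) (ℕₚ.+-identityʳ (suc π))
               (p-step (ev-Pow additive *-closed {0} {q} {g} any pg))))
      where
      q = proj₁ (geom-exp prime char e)
      eq : ev (X e ×R.^ suc π) g ℤ.+ p ×ℤ.× ev q g ≡ ∑ (allFin p) (λ c → g (toℕ c × e))
      eq = trans (cong (ℤ._+_ (ev (X e ×R.^ suc π) g)) (sym (ev-× p q g)))
        (trans (sym (ev-++ (X e ×R.^ suc π) (p ×R.× q) g))
          (trans (sym (ev-≡ (proj₂ (geom-exp prime char e)) g)) (ev-geom e p g)))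

  Δ-translate : ∀ hs (g : A → ℤ) a y → T.Δ hs (λ z → g (a + z)) y ≡ T.Δ hs g (a + y)
  Δ-translate []       g a y = refl
  Δ-translate (h ∷ hs) g a y = trans
    (T.Δ-cong hs (λ z → cong (λ w → g w ℤ.- g (a + z))
        (trans (sym (A.+-assoc a h z)) (trans (cong (_+ z) (A.+-comm a h)) (A.+-assoc h a z)))) y)
    (Δ-translate hs (T.∂ h g) a y)

  Δ-translateʳ : ∀ hs (g : A → ℤ) a y → T.Δ hs (λ z → g (z + a)) y ≡ T.Δ hs g (y + a)
  Δ-translateʳ hs g a y = trans (T.Δ-cong hs (λ z → cong g (A.+-comm z a)) y)
    (trans (Δ-translate hs g a y) (cong (T.Δ hs g) (A.+-comm a y)))

  shift-summable : ∀ {V} k → IsSummable V → IsSummable (λ t → V (k ℕ.+ t))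
  shift-summable {V} k sV = record
    { additive = record { resp = resp ; zero∈ = zero∈ ; add = add }
    ; *-closed = *-closed
    ; p-step   = λ {t} {x} v → ≡.subst (λ m → V m (p ×ℤ.× x)) (lem k (suc π) t) (p-step v) }
    where
    open IsSummable sV
    open T.IsAdditive additive
    lem : ∀ a b c → b ℕ.+ (a ℕ.+ c) ≡ a ℕ.+ (b ℕ.+ c)
    lem a b c = trans (sym (ℕₚ.+-assoc b a c)) (trans (cong (ℕ._+ c) (ℕₚ.+-comm b a)) (ℕₚ.+-assoc a b c))

  -- Differences commute with the sum, so `∑-multiples` applies to the differenced function, in the
  -- family shifted by the differences already taken.
  Prof-∑-multiples : ∀ {V} → IsSummable V → ∀ e {g} → T.Prof V g →
    T.Prof (λ t → V (suc π ℕ.+ t)) (λ y → ∑ (allFin p) (λ c → g ((toℕ c × e) + y)))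
  Prof-∑-multiples {V} sV e {g} pg hs y = ≡.subst (V (suc π ℕ.+ length hs)) (sym eq)
    (≡.subst (λ t → V t (∑ (allFin p) (λ c → h (toℕ c × e)))) (ℕₚ.+-comm (length hs) (suc π))
      (∑-multiples (shift-summable (length hs) sV) e prof-h))
    where
    h : A → ℤ
    h a = T.Δ hs g (a + y)
    eq : T.Δ hs (λ y → ∑ (allFin p) (λ c → g ((toℕ c × e) + y))) y ≡ ∑ (allFin p) (λ c → h (toℕ c × e))
    eq = trans (Δ-∑ _+_ hs (allFin p) (λ c z → g ((toℕ c × e) + z)) y)
        (∑-cong (allFin p) (λ c → Δ-translate hs g (toℕ c × e) y))
    prof-h : T.Prof (λ t → V (length hs ℕ.+ t)) h
    prof-h ls a = ≡.subst (V (length hs ℕ.+ length ls))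
        (sym (trans (Δ-translateʳ ls (T.Δ hs g) y a) (T.Δ-++ hs ls g (a + y))))
      (≡.subst (λ t → V t (T.Δ (hs ++ ls) g (a + y))) (Listₚ.length-++ hs) (pg (hs ++ ls) (a + y)))

  ∑-span : ∀ {V} → IsSummable V → ∀ {k} (es : Vec A k) {g} → T.Prof V g →
           V (k ℕ.* suc π) (∑ (coefficients p k) (λ cs → g (combFin es cs)))
  ∑-span {V} sV []       {g} pg = ≡.subst (V 0) (sym (ℤₚ.+-identityʳ (g 0#))) (pg [] 0#)
  ∑-span {V} sV {suc k} (e ∷ es) {g} pg = ≡.subst (V (suc k ℕ.* suc π))
      (sym (∑-cartesianProductWith (λ cs c → c ∷ cs) (coefficients p k) (allFin p)
          (λ cs → g (combFin (e ∷ es) cs))))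
    (∑-span (shift-summable (suc π) sV) es (Prof-∑-multiples sV e pg))

-- The additive group of a finite field

unique-⊆⇒↭ : ∀ {A : Set} {xs ys : List A} → Unique xs → xs ⊆ ys → ∃ λ zs → ys ↭ xs ++ zs
unique-⊆⇒↭ {xs = []} {ys} _ _ = ys , Perm.refl
unique-⊆⇒↭ {xs = x ∷ xs} {ys} (x∉xs ∷ u) sub with ∈-∃++ (sub (here refl))
... | as , bs , refl with unique-⊆⇒↭ {xs = xs} {as ++ bs} u sub′
  where
  sub′ : xs ⊆ as ++ bs
  sub′ {y} y∈xs with ∈-++⁻ as (sub (there y∈xs))
  ... | inj₁ y∈as          = ∈-++⁺ˡ y∈as
  ... | inj₂ (here refl)   = ⊥-elim (All.lookup x∉xs y∈xs refl)
  ... | inj₂ (there y∈bs)  = ∈-++⁺ʳ as y∈bs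
... | zs , p = zs , ↭-trans (Permₚ.shift x as bs) (Perm.prep x p)

unique-⊆⇒length≤ : ∀ {A : Set} {xs ys : List A} → Unique xs → xs ⊆ ys → length xs ≤ length ys
unique-⊆⇒length≤ {xs = xs} u sub with unique-⊆⇒↭ u sub
... | zs , p = ≡.subst (length xs ≤_) (sym (trans (Permₚ.↭-length p) (Listₚ.length-++ xs))) (ℕₚ.m≤m+n _ _)

unique-⊆-length⇒↭ : ∀ {A : Set} {xs ys : List A} → Unique xs → xs ⊆ ys → length xs ≡ length ys → ys ↭ xs
unique-⊆-length⇒↭ {xs = xs} {ys} u sub len with unique-⊆⇒↭ u sub
... | []     , p = ≡.subst (ys ↭_) (Listₚ.++-identityʳ xs) p
... | z ∷ zs , p = ⊥-elim (ℕₚ.m≢1+m+n (length xs) (trans len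
    (trans (Permₚ.↭-length p) (trans (Listₚ.length-++ xs) (ℕₚ.+-suc _ _)))))

length-cartesianProductWith : ∀ {A B C : Set} (f : A → B → C) xs ys →
  length (cartesianProductWith f xs ys) ≡ length xs ℕ.* length ys
length-cartesianProductWith f []       ys = refl
length-cartesianProductWith f (x ∷ xs) ys = trans (Listₚ.length-++ (map (f x) ys))
  (cong₂ ℕ._+_ (Listₚ.length-map (f x) ys) (length-cartesianProductWith f xs ys))

module FieldStructure (F : FiniteField) where
  open FiniteField F
  ring : CommutativeRing 0ℓ 0ℓ
  ring = ≡-ring isCommutativeRing
  module K = CommutativeRing ring
  open RingLemmas ring using (_×_; _^_; ×-congʳ; ×-assoc-*; ×-zeroʳ; ×-assocˡ; ×-homo-+; ×-homo-1)
  open import Data.List.Membership.DecPropositional _≟_ using (_∈?_)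
  open import Algebra.Properties.Semiring.Mult K.semiring using (×1-homo-*)
  open import Algebra.Properties.CommutativeMonoid.Mult K.+-commutativeMonoid using (×-distrib-+)
  open import Algebra.Properties.CommutativeSemiring.Exp K.commutativeSemiring using (^-distrib-*)
  open import Algebra.Properties.Group K.+-group using () renaming (∙-cancelˡ to +-cancelˡ)
  open import Algebra.Properties.CommutativeSemigroup K.+-commutativeSemigroup using (x∙yz≈y∙xz; interchange)

  elements-unique : Unique elements
  elements-unique = Uniqueₚ.map⁺ (Injection.injective (Inverse⇒Injection enum)) (Uniqueₚ.allFin⁺ card)

  ∈-elements : ∀ x → x ∈ˡ elements
  ∈-elements x = ≡.subst (_∈ˡ elements) (Inverse.strictlyInverseˡ enum x)
      (∈-map⁺ (Inverse.to enum) (∈-allFin (Inverse.from enum x)))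

  length-elements : length elements ≡ card
  length-elements = trans (Listₚ.length-map _ (allFin card)) (Listₚ.length-tabulate (λ i → i))

  total : List Carrier → Carrier
  total = foldr _+_ 0#

  total-↭ : ∀ {xs ys} → xs ↭ ys → total xs ≡ total ys
  total-↭ Perm.refl         = refl
  total-↭ (Perm.prep x p)   = cong (x +_) (total-↭ p)
  total-↭ (Perm.swap x y p) = trans (cong (λ z → x + (y + z)) (total-↭ p)) (x∙yz≈y∙xz x y _)
  total-↭ (Perm.trans p q)  = trans (total-↭ p) (total-↭ q)

  total-translate : ∀ a xs → total (map (a +_) xs) ≡ length xs × a + total xs
  total-translate a []       = sym (K.+-identityˡ 0#)
  total-translate a (x ∷ xs) = trans (cong (λ z → a + x + z) (total-translate a xs)) (interchange a x _ _)

  -- Translation by 1 permutes the field, so the sum of all elements equals itself plus card × 1.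
  card×1≡0 : card × 1# ≡ 0#
  card×1≡0 = +-cancelˡ (total elements) _ _ (trans (K.+-comm _ _) (trans
    (trans (cong (λ n → n × 1# + total elements) (sym length-elements)) (sym (total-translate 1# elements)))
    (trans (sym (total-↭ (unique-⊆-length⇒↭ (Uniqueₚ.map⁺ (+-cancelˡ 1# _ _) elements-unique)
        (λ _ → ∈-elements _) (Listₚ.length-map _ elements))))
      (sym (K.+-identityʳ _)))))

  x*y≡0⇒y≡0 : ∀ {x y} → x ≢ 0# → x * y ≡ 0# → y ≡ 0#
  x*y≡0⇒y≡0 {x} {y} x≢0 xy≡0 with inverse x x≢0
  ... | z , xz≡1 = trans (sym (K.*-identityˡ y)) (trans (cong (_* y) (trans (sym xz≡1) (K.*-comm x z)))
    (trans (K.*-assoc z x y) (trans (cong (z *_) xy≡0) (K.zeroʳ z))))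

  ^≡0⇒≡0 : ∀ x n → x ^ n ≡ 0# → x ≡ 0#
  ^≡0⇒≡0 x zero    e = ⊥-elim (0≢1 (sym e))
  ^≡0⇒≡0 x (suc n) e with x ≟ 0#
  ... | yes x≡0 = x≡0
  ... | no  x≢0 = ^≡0⇒≡0 x n (x*y≡0⇒y≡0 x≢0 e)

  pow≡^ : ∀ x n → pow x n ≡ x ^ n
  pow≡^ x zero    = refl
  pow≡^ x (suc n) = cong (x *_) (pow≡^ x n)

  module PrimePower {π s : ℕ} (prime : Prime (suc (suc π))) (card≡ : card ≡ suc (suc π) ℕ.^ s) where
    private
      p : ℕ
      p = suc (suc π)

    ×1-^ : ∀ n m → (n ℕ.^ m) × 1# ≡ (n × 1#) ^ m
    ×1-^ n zero    = ×-homo-1 1#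
    ×1-^ n (suc m) = trans (×1-homo-* n (n ℕ.^ m)) (cong ((n × 1#) *_) (×1-^ n m))

    -- The s-th power of p × 1 is p^s × 1 = card × 1 = 0, and a field has no nilpotent elements
    -- except 0.
    char : ∀ x → p × x ≡ 0#
    char x = trans (×-congʳ p (sym (K.*-identityˡ x))) (trans (sym (×-assoc-* p 1# x))
      (trans (cong (_* x) (^≡0⇒≡0 (p × 1#) s (trans (sym (×1-^ p s))
          (trans (cong (_× 1#) (sym card≡)) card×1≡0)))) (K.zeroˡ x)))

    [1+x]^p : ∀ x → (1# + x) ^ p ≡ 1# + x ^ p
    [1+x]^p x = reduce (RingLemmas.x^p+px ring prime x)
      where
      reduce : (∃ λ q → (1# + x) ^ p ≡ 1# + (x ^ p + p × (x * q))) → (1# + x) ^ p ≡ 1# + x ^ p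
      reduce (q , e) = trans e (cong (1# +_) (trans (cong (x ^ p +_) (char (x * q))) (K.+-identityʳ _)))

    -- For y ≠ 0 write x + y = y (1 + x / y), which reduces the claim to `[1+x]^p`.
    frobenius-+ : ∀ x y → pow (x + y) p ≡ pow x p + pow y p
    frobenius-+ x y = trans (pow≡^ (x + y) p) (trans (go (y ≟ 0#)) (sym (cong₂ _+_ (pow≡^ x p) (pow≡^ y p))))
      where
      go : _ → (x + y) ^ p ≡ x ^ p + y ^ p
      go (yes refl) = trans (cong (_^ p) (K.+-identityʳ x))
        (trans (sym (K.+-identityʳ (x ^ p))) (cong (x ^ p +_) (sym (K.zeroˡ (0# ^ suc π)))))
      go (no y≢0) with inverse y y≢0
      ... | z , yz≡1 = trans (cong (_^ p) factor) (trans (^-distrib-* y (1# + x * z) p)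
        (trans (cong (y ^ p *_) ([1+x]^p (x * z))) (trans (K.distribˡ (y ^ p) 1# _)
          (trans (cong₂ _+_ (K.*-identityʳ _) (trans (sym (^-distrib-* y (x * z) p)) (cong (_^ p) cancel)))
              (K.+-comm _ _)))))
        where
        cancel : y * (x * z) ≡ x
        cancel = trans (cong (y *_) (K.*-comm x z))
            (trans (sym (K.*-assoc y z x)) (trans (cong (_* x) yz≡1) (K.*-identityˡ x)))
        factor : x + y ≡ y * (1# + x * z)
        factor = sym (trans (K.distribˡ y 1# _) (trans (cong₂ _+_ (K.*-identityʳ y) cancel) (K.+-comm y x)))

    open Combinations ring

    comb-+ : ∀ {k} ms ns (es : Vec Carrier k) → comb ms es + comb ns es ≡ comb (Vec.zipWith ℕ._+_ ms ns) es
    comb-+ []       []       []       = K.+-identityˡ 0#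
    comb-+ (m ∷ ms) (n ∷ ns) (e ∷ es) = trans (interchange (m × e) _ (n × e) _)
      (cong₂ _+_ (sym (×-homo-+ e m n)) (comb-+ ms ns es))

    comb-× : ∀ {k} m ns (es : Vec Carrier k) → m × comb ns es ≡ comb (Vec.map (m ℕ.*_) ns) es
    comb-× m []       []       = ×-zeroʳ m
    comb-× m (n ∷ ns) (e ∷ es) = trans (×-distrib-+ (n × e) (comb ns es) m)
        (cong₂ _+_ (×-assocˡ e m n) (comb-× m ns es))

    comb-% : ∀ {k} ns (es : Vec Carrier k) → comb ns es ≡ combFin es (Vec.map (DivMod._mod p) ns)
    comb-% []       []       = refl
    comb-% (n ∷ ns) (e ∷ es) = cong₂ _+_ (trans (cong (_× e) (DivMod.m≡m%n+[m/n]*n n p))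
      (trans (×-homo-+ e (n ℕ.% p) (n ℕ./ p ℕ.* p))
          (trans (cong₂ _+_ (cong (_× e) (sym (Finₚ.toℕ-fromℕ< (DivMod.m%n<n n p))))
        (trans (sym (×-assocˡ e (n ℕ./ p) p)) (trans (×-congʳ (n ℕ./ p) (char e)) (×-zeroʳ (n ℕ./ p)))))
            (K.+-identityʳ _)))) (comb-% ns es)

    -- Natural coefficients make closure under sums and multiples immediate, with p - 1 serving as
    -- -1; `comb-%` reduces them modulo p where the span has to be counted.
    InSpan : ∀ {k} → Vec Carrier k → Carrier → Set
    InSpan es x = ∃ λ ns → x ≡ comb ns es

    InSpan-+ : ∀ {k} {es : Vec Carrier k} {x y} → InSpan es x → InSpan es y → InSpan es (x + y)
    InSpan-+ {es = es} (ms , refl) (ns , refl) = Vec.zipWith ℕ._+_ ms ns , comb-+ ms ns es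

    InSpan-× : ∀ {k} {es : Vec Carrier k} {x} m → InSpan es x → InSpan es (m × x)
    InSpan-× {es = es} m (ns , refl) = Vec.map (m ℕ.*_) ns , comb-× m ns es

    -- Bézout's identity for p and d inverts d modulo p.
    InSpan-divide : ∀ {k} {es : Vec Carrier k} {d x} → 0 < d → d < p → InSpan es (d × x) → InSpan es x
    InSpan-divide {es = es} {suc d} {x} _ d<p dx with coprime-Bézout (prime⇒coprime prime d<p)
    ... | Bézout.-+ u v eq = ≡.subst (InSpan es) inv (InSpan-× v dx)
      where
      inv : v × (suc d × x) ≡ x
      inv = trans (×-assocˡ x v (suc d)) (trans (cong (_× x) (sym eq))
          (trans (cong (x +_) (trans (sym (×-assocˡ x u p))
        (trans (×-congʳ u (char x)) (×-zeroʳ u)))) (K.+-identityʳ x)))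
    -- In this case v d is -1 modulo p, and the multiple p - 1 corrects the sign.
    ... | Bézout.+- u v eq = ≡.subst (InSpan es) inv (InSpan-× (suc π) (InSpan-× v dx))
      where
      y = v × (suc d × x)
      x+y≡0 : x + y ≡ 0#
      x+y≡0 = trans (cong (x +_) (×-assocˡ x v (suc d)))
          (trans (cong (_× x) eq) (trans (sym (×-assocˡ x u p)) (trans (×-congʳ u (char x)) (×-zeroʳ u))))
      inv : suc π × y ≡ x
      inv = +-cancelˡ y _ _ (trans (char y) (sym (trans (K.+-comm y x) x+y≡0)))

    -- Cancelling c × e leaves (d - c) × e = y - z with y and z in the span of `es`; -z is the
    -- multiple (p - 1) × z, and d - c can be divided out.
    dependent : ∀ {k e} {es : Vec Carrier k} (c d : Fin p) (cs ds : Vec (Fin p) k) → toℕ c < toℕ d →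
                combFin (e ∷ es) (c ∷ cs) ≡ combFin (e ∷ es) (d ∷ ds) → InSpan es e
    dependent {e = e} {es} c d cs ds c<d eq =
      InSpan-divide {es = es} (ℕₚ.m<n⇒0<n∸m c<d) (ℕₚ.≤-<-trans (ℕₚ.m∸n≤m (toℕ d) (toℕ c)) (Finₚ.toℕ<n d))
        (≡.subst (InSpan es) (sym difference) (InSpan-+ {es = es} (Vec.map toℕ cs , refl)
            (InSpan-× {es = es} (suc π) (Vec.map toℕ ds , refl))))
      where
      δ = toℕ d ∸ toℕ c
      y = combFin es cs
      z = combFin es ds
      y≡ : y ≡ δ × e + z
      y≡ = +-cancelˡ (toℕ c × e) _ _ (trans eq (trans (cong (λ m → m × e + z) (sym (ℕₚ.m+[n∸m]≡n (ℕₚ.<⇒≤ c<d))))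
        (trans (cong (_+ z) (×-homo-+ e (toℕ c) δ)) (K.+-assoc _ _ z))))
      difference : δ × e ≡ y + suc π × z
      difference = sym (trans (cong (_+ suc π × z) y≡)
          (trans (K.+-assoc _ z _) (trans (cong (δ × e +_) (char z)) (K.+-identityʳ _))))

    Independent : ∀ {k} → Vec Carrier k → Set
    Independent {k} es = ∀ {cs ds : Vec (Fin p) k} → combFin es cs ≡ combFin es ds → cs ≡ ds

    independent-∷ : ∀ {k e} {es : Vec Carrier k} → Independent es → ¬ InSpan es e → Independent (e ∷ es)
    independent-∷ {e = e} {es} ind e∉ {c ∷ cs} {d ∷ ds} eq with ℕₚ.<-cmp (toℕ c) (toℕ d)
    ... | tri< c<d _ _ = ⊥-elim (e∉ (dependent {es = es} c d cs ds c<d eq))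
    ... | tri> _ _ d<c = ⊥-elim (e∉ (dependent {es = es} d c ds cs d<c (sym eq)))
    ... | tri≈ _ c≡d _ with Finₚ.toℕ-injective c≡d
    ...   | refl = cong (c ∷_) (ind (+-cancelˡ _ _ _ eq))

    coefficients-unique : ∀ k → Unique (coefficients p k)
    coefficients-unique zero    = [] ∷ []
    coefficients-unique (suc k) = Uniqueₚ.cartesianProductWith⁺ (λ cs c → c ∷ cs)
      (λ eq → Vecₚ.∷-injectiveʳ eq , Vecₚ.∷-injectiveˡ eq) (coefficients-unique k) (Uniqueₚ.allFin⁺ p)

    ∈-coefficients : ∀ {k} (cs : Vec (Fin p) k) → cs ∈ˡ coefficients p k
    ∈-coefficients []       = here refl
    ∈-coefficients (c ∷ cs) = ∈-cartesianProductWith⁺ (λ cs c → c ∷ cs) (∈-coefficients cs) (∈-allFin c)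

    length-coefficients : ∀ k → length (coefficients p k) ≡ p ℕ.^ k
    length-coefficients zero    = refl
    length-coefficients (suc k) = trans (length-cartesianProductWith (λ cs c → c ∷ cs) (coefficients p k)
        (allFin p))
      (trans (cong₂ ℕ._*_ (length-coefficients k) (Listₚ.length-tabulate {n = p} (λ i → i)))
          (ℕₚ.*-comm (p ℕ.^ k) p))

    span : ∀ {k} → Vec Carrier k → List Carrier
    span {k} es = map (combFin es) (coefficients p k)

    length-span : ∀ {k} (es : Vec Carrier k) → length (span es) ≡ p ℕ.^ k
    length-span {k} es = trans (Listₚ.length-map (combFin es) (coefficients p k)) (length-coefficients k)

    InSpan⇒∈ : ∀ {k} (es : Vec Carrier k) {x} → InSpan es x → x ∈ˡ span es
    InSpan⇒∈ es (ns , refl) = ≡.subst (_∈ˡ span es) (sym (comb-% ns es))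
        (∈-map⁺ (combFin es) (∈-coefficients (Vec.map (DivMod._mod p) ns)))

    ∈⇒InSpan : ∀ {k} (es : Vec Carrier k) {x} → x ∈ˡ span es → InSpan es x
    ∈⇒InSpan es x∈ with ∈-map⁻ (combFin es) x∈
    ... | cs , _ , eq = Vec.map toℕ cs , eq

    -- The span is listed with p^k < p^s entries, too few to contain the duplicate-free list of all
    -- elements.
    outside-span : ∀ {k} (es : Vec Carrier k) → k < s → ∃ λ e → ¬ InSpan es e
    outside-span {k} es k<s with Any.any? (λ x → ¬? (x ∈? span es)) elements
    ... | yes found = let (e , _ , e∉) = find found in e , λ e∈ → e∉ (InSpan⇒∈ es e∈)
    ... | no  none  = ⊥-elim (ℕₚ.<⇒≱ (ℕₚ.^-monoʳ-< p (s≤s (s≤s z≤n)) k<s)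
      (≡.subst₂ _≤_ (trans length-elements card≡) (length-span es)
        (unique-⊆⇒length≤ elements-unique (λ {x} x∈ → decidable-stable (x ∈? span es)
            (λ x∉ → none (lose x∈ x∉))))))

    independent-family : ∀ k → k ≤ s → ∃ λ (es : Vec Carrier k) → Independent es
    independent-family zero    _   = [] , λ { {[]} {[]} _ → refl }
    independent-family (suc k) k<s with independent-family k (ℕₚ.<⇒≤ k<s)
    ... | es , ind with outside-span es k<s
    ...   | e , e∉ = e ∷ es , independent-∷ {es = es} ind e∉

    basis : Vec Carrier s
    basis = proj₁ (independent-family s ℕₚ.≤-refl)

    -- Independence makes the p^s combinations distinct, and the field has just as many elements;
    -- spanning thus follows from counting.
    elements↭span : elements ↭ span basis
    elements↭span = unique-⊆-length⇒↭
      (Uniqueₚ.map⁺ (proj₂ (independent-family s ℕₚ.≤-refl)) (coefficients-unique s))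
      (λ _ → ∈-elements _) (trans (length-span basis) (trans (sym card≡) (sym length-elements)))

    basis-spans : ∀ x → InSpan basis x
    basis-spans x = ∈⇒InSpan basis (Permₚ.∈-resp-↭ elements↭span (∈-elements x))

-- Polynomial functions and digit sums

module PolynomialDegree (F : FiniteField) {π s : ℕ} (prime : Prime (suc (suc π)))
         (card≡ : FiniteField.card F ≡ suc (suc π) ℕ.^ s)
         {Y M : Set} (act : M → Y → Y) where
  open FiniteField F
  open FieldStructure F using (ring; module K; module PrimePower)
  open PrimePower {π} {s} prime card≡ using (frobenius-+)
  open Degree ring act
  private
    p : ℕ
    p = suc (suc π)

  pow-+ : ∀ x m n → pow x (m ℕ.+ n) ≡ pow x m * pow x n
  pow-+ x zero    n = sym (K.*-identityˡ _)
  pow-+ x (suc m) n = trans (cong (x *_) (pow-+ x m n)) (sym (K.*-assoc x _ _))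

  pow-* : ∀ x m n → pow x (m ℕ.* n) ≡ pow (pow x n) m
  pow-* x zero    n = refl
  pow-* x (suc m) n = trans (pow-+ x n (m ℕ.* n)) (cong (pow x n *_) (pow-* x m n))

  Affine-frobenius : ∀ {u} → Affine u → Affine (λ y → pow (u y) p)
  Affine-frobenius {u} aff m = pow (proj₁ (aff m)) p , λ y →
    trans (cong (λ x → pow x p) (proj₂ (aff m) y)) (frobenius-+ (proj₁ (aff m)) (u y))

  Deg-pow : ∀ {u} → Affine u → ∀ m → Deg m (λ y → pow (u y) m)
  Deg-pow aff zero    = Deg-invariant (λ _ _ → refl)
  Deg-pow aff (suc m) = Deg-* {1} {m} (Deg-affine aff) (Deg-pow aff m)

  -- Splitting off the lowest digit gives u^m = u^(m mod p) (u^p)^(m / p). Since u^p is again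
  -- affine, the recursion restarts with u^p, and each digit contributes its value without the
  -- weight of its place.
  Deg-pow-σ-fuel : ∀ k m → m ≤ k → ∀ {u} → Affine u → Deg (σ-fuel k p m) (λ y → pow (u y) m)
  Deg-pow-σ-fuel zero    zero z≤n aff = Deg-invariant (λ _ _ → refl)
  Deg-pow-σ-fuel (suc k) m m≤ {u} aff =
    Deg-cong (λ y → sym (trans (cong (pow (u y)) (DivMod.m≡m%n+[m/n]*n m p))
                       (trans (pow-+ (u y) (m ℕ.% p) (m ℕ./ p ℕ.* p))
                           (cong (pow (u y) (m ℕ.% p) *_) (pow-* (u y) (m ℕ./ p) p)))))
      (Deg-* {m ℕ.% p} {σ-fuel k p (m ℕ./ p)} (Deg-pow aff (m ℕ.% p))
        (Deg-pow-σ-fuel k (m ℕ./ p) (quotient-≤ m m≤) (Affine-frobenius aff)))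
    where
    quotient-≤ : ∀ m → m ≤ suc k → m ℕ./ p ≤ k
    quotient-≤ zero    _  = z≤n
    quotient-≤ (suc m) m≤ = ℕ.s≤s⁻¹ (ℕₚ.≤-trans (DivMod.m/n<m (suc m) p (s≤s (s≤s z≤n))) m≤)

  Deg-pow-σ : ∀ {u} → Affine u → ∀ m → Deg (σ p m) (λ y → pow (u y) m)
  Deg-pow-σ aff m = Deg-pow-σ-fuel m m ℕₚ.≤-refl aff

  Deg-scale : ∀ {w u} a → Deg w u → Deg w (λ y → a * u y)
  Deg-scale a du = Deg-* {0} (Deg-invariant (λ _ _ → refl)) du

  Deg-evalU : ∀ f {u} → Affine u → Deg (wU p f) (λ y → evalU F f (u y))
  Deg-evalU []            aff = Deg-invariant (λ _ _ → refl)
  Deg-evalU ((b , m) ∷ f) aff = Deg-+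
    (Deg-mono (ℕₚ.m≤m⊔n (σ p m) (wU p f)) (Deg-scale b (Deg-pow-σ aff m)))
    (Deg-mono (ℕₚ.m≤n⊔m (σ p m) (wU p f)) (Deg-evalU f aff))

  -- Only the coordinates in the chosen subset are ever moved. The others are constants for the
  -- differences and contribute degree 0, matching a weight that ignores their exponents.
  Coordinate : Bool → (Y → Carrier) → Set
  Coordinate true  u = Affine u
  Coordinate false u = Invariant u

  at : ∀ {n} → Vec (Y → Carrier) n → Y → Vec Carrier n
  at us y = Vec.map (λ u → u y) us

  Deg-monomial : ∀ {n} (I : Subset n) us → (∀ i → Coordinate (lookup I i) (lookup us i)) → ∀ m →
                 Deg (wMono p I m) (λ y → Vec.foldr _ _*_ 1# (Vec.zipWith pow (at us y) m))
  Deg-monomial []      []       coord []      = Deg-invariant (λ _ _ → refl)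
  Deg-monomial (b ∷ I) (u ∷ us) coord (m ∷ ms) =
    Deg-* {if b then σ p m else 0} {wMono p I ms} (factor b (coord zero))
        (Deg-monomial I us (λ i → coord (suc i)) ms)
    where
    factor : ∀ b → Coordinate b u → Deg (if b then σ p m else 0) (λ y → pow (u y) m)
    factor true  aff = Deg-pow-σ aff m
    factor false inv = Deg-invariant (λ h y → cong (λ x → pow x m) (inv h y))

  Deg-evalM : ∀ {n} (I : Subset n) us → (∀ i → Coordinate (lookup I i) (lookup us i)) → ∀ P →
              Deg (wM p I P) (λ y → evalM F P (at us y))
  Deg-evalM I us coord []            = Deg-invariant (λ _ _ → refl)
  Deg-evalM I us coord ((a , m) ∷ P) = Deg-+
    (Deg-mono (ℕₚ.m≤m⊔n (wMono p I m) (wM p I P)) (Deg-scale a (Deg-monomial I us coord m)))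
    (Deg-mono (ℕₚ.m≤n⊔m (wMono p I m) (wM p I P)) (Deg-evalM I us coord P))

-- The number of zeros

open import Data.Integer using (+_)

∏ : ∀ r → (Fin r → ℤ) → ℤ
∏ zero    g = 1ℤ
∏ (suc r) g = g zero ℤ.* ∏ r (λ j → g (suc j))

∏-one : ∀ r {g} → (∀ j → g j ≡ 1ℤ) → ∏ r g ≡ 1ℤ
∏-one zero    _   = refl
∏-one (suc r) g≡1 = cong₂ ℤ._*_ (g≡1 zero) (∏-one r (λ j → g≡1 (suc j)))

∏-zero : ∀ r {g} j → g j ≡ 0ℤ → ∏ r g ≡ 0ℤ
∏-zero (suc r) {g} zero    e = cong (ℤ._* ∏ r (λ j → g (suc j))) e
∏-zero (suc r) {g} (suc j) e = trans (cong (g zero ℤ.*_) (∏-zero r j e)) (ℤₚ.*-zeroʳ (g zero))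

length-filter-∑ : ∀ {X : Set} {Q : X → Set} (dec : ∀ x → Dec (Q x)) (h : X → ℤ) →
  (∀ x → Q x → h x ≡ 1ℤ) → (∀ x → ¬ Q x → h x ≡ 0ℤ) → ∀ xs → + length (filter dec xs) ≡ ∑ xs h
length-filter-∑ dec h one none []       = refl
length-filter-∑ dec h one none (x ∷ xs) with dec x
... | yes q = trans (cong (ℤ._+_ 1ℤ) (length-filter-∑ dec h one none xs)) (cong (ℤ._+ ∑ xs h) (sym (one x q)))
... | no ¬q = trans (sym (ℤₚ.+-identityˡ _)) (cong₂ ℤ._+_ (sym (none x ¬q)) (length-filter-∑ dec h one none xs))

≤-maxℕ : ∀ r (w : Fin r → ℕ) j → w j ≤ maxℕ r w
≤-maxℕ (suc r) w zero    = ℕₚ.m≤m⊔n (w zero) _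
≤-maxℕ (suc r) w (suc j) = ℕₚ.≤-trans (≤-maxℕ r (λ j → w (suc j)) j) (ℕₚ.m≤n⊔m (w zero) _)

×≡+* : ∀ n q → RingLemmas._×_ ℤ-ring n q ≡ + n ℤ.* q
×≡+* zero    q = sym (ℤₚ.*-zeroˡ q)
×≡+* (suc n) q = trans (cong (ℤ._+_ q) (×≡+* n q)) (sym (ℤₚ.suc-* (+ n) q))

Div⇒∣ : ∀ {n N} → RingLemmas.Div ℤ-ring n (+ N) → n ∣ N
Div⇒∣ {n} {N} (q , eq) = divides ℤ.∣ q ∣ (trans (cong ℤ.∣_∣ (trans eq (×≡+* n q)))
  (trans (ℤₚ.abs-* (+ n) q) (ℕₚ.*-comm n ℤ.∣ q ∣)))

module Zeros (F : FiniteField) {π s : ℕ} (prime : Prime (suc (suc π)))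
            (card≡ : FiniteField.card F ≡ suc (suc π) ℕ.^ s) where
  open FiniteField F
  open FieldStructure F using (ring; module K; module PrimePower)
  open PrimePower {π} {s} prime card≡ using (char; span; InSpan; basis; basis-spans; elements↭span)
  open Evaluation isCommutativeRing
  open Summation isCommutativeRing prime char
  open Combinations ring
  open Unipotent isCommutativeRing commutativeRing [_] [∙]-homo R.refl using (Pow⇒Val)
  private
    module ×R = RingLemmas commutativeRing
    module ×ℤ = RingLemmas ℤ-ring
    p : ℕ
    p = suc (suc π)

  -- The two uses of a basis: `spans` provides generators of the augmentation ideal, and `lists`,
  -- which also contains independence, an enumeration for sums over the field.
  record Basis : Set where
    field
      vectors : Vec Carrier s
      spans   : ∀ x → InSpan vectors x
      lists   : elements ↭ span vectors

  field-basis : Basis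
  field-basis = record { vectors = basis ; spans = basis-spans ; lists = elements↭span }

  data Move : ∀ {n} → Subset n → Set where
    shift-head : ∀ {n} {I : Subset n} → Carrier → Move (true ∷ I)
    in-tail    : ∀ {n b} {I : Subset n} → Move I → Move (b ∷ I)

  move : ∀ {n} {I : Subset n} → Move I → Vec Carrier n → Vec Carrier n
  move (shift-head h)  (x ∷ y) = h + x ∷ y
  move (in-tail m) (x ∷ y) = x ∷ move m y

  module Divisibility (𝔅 : Basis) where
    open Basis 𝔅

    -- The function g is arbitrary, because the estimate is made for [φ] and then evaluated at g.
    -- The slope is weakened from w (p - 1) to (D + 1)(p - 1), so that the factors in `Prof-∏` share
    -- one slope.
    Prof-∘ : ∀ {Y M : Set} (act : M → Y → Y) (g : Carrier → ℤ) {w φ} D → w ≤ suc D → Degree.Deg ring act w φ →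
             Differences.Prof ℤ-ring act (×ℤ.Val p (w ℕ.* (s ℕ.* suc π)) (suc D ℕ.* suc π)) (λ y → g (φ y))
    Prof-∘ act g {zero} D w≤ deg [] y = ×ℤ.Val-0 p 0 (suc D ℕ.* suc π)
    Prof-∘ act g {zero} {φ} D w≤ deg (m ∷ ms) y =
      resp (sym (Differences.Δ-invariant ℤ-ring act m ms (λ m z → cong g (inv m z)) y)) zero∈
      where
      open Filtrations.IsFiltration (×ℤ.Val-filtration p 0 (π ℕ.+ D ℕ.* suc π))
      inv : ∀ m z → φ (act m z) ≡ φ z
      inv m z = Degree.Deg0⇒Invariant ring act deg m z
    Prof-∘ act g {suc w} {φ} D w≤ deg ms y = combine (Prof-exp w deg ms y)
      where
      open Composition act
      combine : Level (suc w) (length ms) (DR.Δ ms (λ z → [ φ z ]) y) →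
                ×ℤ.Val p (suc w ℕ.* (s ℕ.* suc π)) (suc D ℕ.* suc π) (length ms)
                    (Differences.Δ ℤ-ring act ms (λ y → g (φ y)) y)
      combine (k , t≤ , pow) = divided (Pow⇒Val prime char vectors spans pow)
        where
        r = DR.Δ ms (λ z → [ φ z ]) y
        divided : ×R.Val p (s ℕ.* suc π) (suc π) k r → _
        divided (e , k≤ , q , r≈) = e , bound , ev q g , trans
          (Differences.Δ-cong ℤ-ring act ms (λ z → sym (ev-[] (φ z) g)) y)
          (trans (sym (Δ-ev act ms (λ z → [ φ z ]) g y)) (trans (ev-≡ r≈ g) (ev-× (p ℕ.^ e) q g)))
          where
          bound : length ms ≤ suc w ℕ.* (s ℕ.* suc π) ℕ.+ suc D ℕ.* suc π ℕ.* e
          bound = begin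
            length ms                                            ≤⟨ t≤ ⟩
            suc w ℕ.* k                                          ≤⟨ ℕₚ.*-monoʳ-≤ (suc w) k≤ ⟩
            suc w ℕ.* (s ℕ.* suc π ℕ.+ suc π ℕ.* e)              ≡⟨ ℕₚ.*-distribˡ-+ (suc w) (s ℕ.* suc π)
                (suc π ℕ.* e) ⟩
            suc w ℕ.* (s ℕ.* suc π) ℕ.+ suc w ℕ.* (suc π ℕ.* e)  ≤⟨ ℕₚ.+-monoʳ-≤ (suc w ℕ.* (s ℕ.* suc π))
                (ℕₚ.*-monoˡ-≤ (suc π ℕ.* e) w≤) ⟩
            suc w ℕ.* (s ℕ.* suc π) ℕ.+ suc D ℕ.* (suc π ℕ.* e)  ≡⟨ cong (suc w ℕ.* (s ℕ.* suc π) ℕ.+_)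
                (ℕₚ.*-assoc (suc D) (suc π) e) ⟨
            suc w ℕ.* (s ℕ.* suc π) ℕ.+ suc D ℕ.* suc π ℕ.* e    ∎
            where open ℕₚ.≤-Reasoning

    Prof-∏ : ∀ {Y M : Set} (act : M → Y → Y) D r (w : Fin r → ℕ) (g : Fin r → Y → ℤ) →
             (∀ j → Differences.Prof ℤ-ring act (×ℤ.Val p (w j) (suc D)) (g j)) →
             Differences.Prof ℤ-ring act (×ℤ.Val p (∑ℕ r w) (suc D)) (λ y → ∏ r (λ j → g j y))
    Prof-∏ act D zero    w g pg []       y = ×ℤ.Val-0 p 0 (suc D)
    Prof-∏ act D zero    w g pg (m ∷ ms) y =
      resp (sym (Differences.Δ-invariant ℤ-ring act m ms {λ _ → 1ℤ} (λ _ _ → refl) y)) zero∈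
      where open Filtrations.IsFiltration (×ℤ.Val-filtration p 0 D)
    Prof-∏ act D (suc r) w g pg = Differences.Prof-* ℤ-ring act
      {×ℤ.Val p (w zero) (suc D)} {×ℤ.Val p (∑ℕ r (λ j → w (suc j))) (suc D)} {×ℤ.Val p (∑ℕ (suc r) w) (suc D)}
      (×ℤ.Val-filtration p (∑ℕ r (λ j → w (suc j))) D)
      (Filtrations.IsFiltration.isAdditive (×ℤ.Val-filtration p (∑ℕ (suc r) w) D))
      (×ℤ.Val-* p (w zero) (∑ℕ r (λ j → w (suc j))) (suc D))
      (pg zero) (Prof-∏ act D r (λ j → w (suc j)) (λ j → g (suc j)) (λ j → pg (suc j)))

    module _ (d D : ℕ) where
      private
        W : ℕ
        W = suc D ℕ.* suc π
        V : T.Family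
        V = ×ℤ.Val p d W
        module V = Filtrations.IsFiltration (×ℤ.Val-filtration p d (π ℕ.+ D ℕ.* suc π))

      V-summable : IsSummable V
      V-summable = record
        { additive = V.isAdditive
        ; *-closed = ×ℤ.Val-*ˡ p d W
        ; p-step   = step }
        where
        step : ∀ {t x} → V t x → V (suc π ℕ.+ t) (p ×ℤ.× x)
        step {t} {x} (e , t≤ , q , x≡) = suc e , bound , q ,
          trans (cong (p ×ℤ.×_) x≡) (×ℤ.×-assocˡ q p (p ℕ.^ e))
          where
          -- In `V` one more factor p buys W = (D + 1)(p - 1) differences, at least the p - 1
          -- demanded.
          bound : suc π ℕ.+ t ≤ d ℕ.+ W ℕ.* suc e
          bound = begin
            suc π ℕ.+ t               ≤⟨ ℕₚ.+-mono-≤ (ℕₚ.m≤m+n (suc π) (D ℕ.* suc π)) t≤ ⟩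
            W ℕ.+ (d ℕ.+ W ℕ.* e)     ≡⟨ ℕₚ.+-assoc W d (W ℕ.* e) ⟨
            W ℕ.+ d ℕ.+ W ℕ.* e       ≡⟨ cong (ℕ._+ W ℕ.* e) (ℕₚ.+-comm W d) ⟩
            d ℕ.+ W ℕ.+ W ℕ.* e       ≡⟨ ℕₚ.+-assoc d W (W ℕ.* e) ⟩
            d ℕ.+ (W ℕ.+ W ℕ.* e)     ≡⟨ cong (d ℕ.+_) (ℕₚ.*-suc W e) ⟨
            d ℕ.+ W ℕ.* suc e         ∎
            where open ℕₚ.≤-Reasoning

      module _ (c w : ℕ) where
        -- The order of g ∘ φ for φ of degree w + 1: taking t differences in the variable of φ
        -- amounts to k differences of g with t ≤ (w + 1) k. The number c stands for order that is
        -- secured beforehand.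
        Scaled : T.Family
        Scaled = Filtrations.Graded ℤ-ring (λ t k → t ≤ suc w ℕ.* k) (λ k → V (c ℕ.+ k))
            (IsSummable.additive (shift-summable c V-summable))

        Scaled-summable : IsSummable Scaled
        Scaled-summable = record
          { additive = Filtrations.IsFiltration.isAdditive
              (Filtrations.Graded-filtration ℤ-ring _ (λ k → V (c ℕ.+ k)) S.additive
              (λ le → ℕₚ.≤-trans (ℕₚ.n≤1+n _) le) (λ t → t , ℕₚ.m≤m+n t (w ℕ.* t))
                  (λ k≤l → V.anti-≤ (ℕₚ.+-monoʳ-≤ c k≤l)))
          ; *-closed = λ { a (k , t≤ , v) → k , t≤ , S.*-closed {k} a v }
          ; p-step   = λ { (k , t≤ , v) → suc π ℕ.+ k ,
              ℕₚ.≤-trans (ℕₚ.+-mono-≤ (ℕₚ.m≤m+n (suc π) (w ℕ.* suc π)) t≤)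
                  (ℕₚ.≤-reflexive (sym (ℕₚ.*-distribˡ-+ (suc w) (suc π) k))) ,
              S.p-step v } }
          where module S = IsSummable (shift-summable c V-summable)

      -- Evaluating the differences of [φ] at g gives g ∘ φ the profile `Scaled`, and `∑-span` over
      -- a basis reaches its level s (p - 1). The conclusion is expressed in differences of g, the
      -- currency that is shared by all variables.
      ∑-elements : ∀ c w {φ} → Degree.Deg ring _+_ (suc w) φ → ∀ {g} → T.Prof (λ t → V (c ℕ.+ t)) g →
                   ∃ λ k → s ℕ.* suc π ≤ suc w ℕ.* k ∧ V (c ℕ.+ k) (∑ elements (λ x → g (φ x)))
      ∑-elements c w {φ} deg {g} pg = ≡.subst (Scaled c w (s ℕ.* suc π)) (sym reindex)
        (∑-span (Scaled-summable c w) vectors prof)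
        where
        module S = IsSummable (shift-summable c V-summable)
        open Composition _+_ using (Prof-exp; module DR)
        prof : T.Prof (Scaled c w) (λ x → g (φ x))
        prof hs y = ≡.subst (Scaled c w (length hs)) eq (evaluate (Prof-exp w deg hs y))
          where
          r = DR.Δ hs (λ z → [ φ z ]) y
          evaluate : Composition.Level _+_ (suc w) (length hs) r → Scaled c w (length hs) (ev r g)
          evaluate (k , t≤ , pow) = k , t≤ , ev-Pow S.additive S.*-closed pow pg
          eq : ev r g ≡ T.Δ hs (λ x → g (φ x)) y
          eq = trans (Δ-ev _+_ hs (λ z → [ φ z ]) g y) (T.Δ-cong hs (λ z → ev-[] (φ z) g) y)
        reindex : ∑ elements (λ x → g (φ x)) ≡ ∑ (coefficients p s) (λ cs → g (φ (combFin vectors cs)))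
        reindex = trans (∑-↭ (λ x → g (φ x)) lists) (∑-map (combFin vectors) (coefficients p s) (λ x → g (φ x)))

      V-∑ : ∀ {X : Set} t (xs : List X) {g} → (∀ x → V t (g x)) → V t (∑ xs g)
      V-∑ t []       v = V.zero∈
      V-∑ t (x ∷ xs) v = V.add (v x) (V-∑ t xs v)

      Δ-shift-head : ∀ {n} {I : Subset n} hs G z y →
        T.Δ hs (λ x → G (x ∷ y)) z ≡ Differences.Δ ℤ-ring (move {I = true ∷ I}) (map shift-head hs) G (z ∷ y)
      Δ-shift-head []       G z y = refl
      Δ-shift-head {I = I} (h ∷ hs) G z y = Δ-shift-head {I = I} hs
          (Differences.∂ ℤ-ring (move {I = true ∷ I}) (shift-head h) G) z y

      Δ-in-tail : ∀ {n b} {I : Subset n} ms G z y →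
        Differences.Δ ℤ-ring (move {I = I}) ms (λ y → G (z ∷ y)) y ≡ Differences.Δ ℤ-ring (move {I = b ∷ I})
            (map in-tail ms) G (z ∷ y)
      Δ-in-tail []       G z y = refl
      Δ-in-tail {b = b} {I} (m ∷ ms) G z y = Δ-in-tail {b = b} {I} ms
          (Differences.∂ ℤ-ring (move {I = b ∷ I}) (in-tail m) G) z y

      -- The tail is summed first, so that the sum over the head sees a function of one variable
      -- whose differences are again sums of differences of G.
      ∑-points : ∀ n (I : Subset n) (f : Fin n → UPoly F) (κ : Fin n → ℕ) →
        (∀ i → lookup I i ≡ true → 0 < wU p (f i) ∧ (∀ k → s ℕ.* suc π ≤ wU p (f i) ℕ.* k → κ i ≤ k)) →
        ∀ c {G} → Differences.Prof ℤ-ring (move {I = I}) (λ t → V (c ℕ.+ t)) G →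
        V (c ℕ.+ ∑ℕ[ I ] κ) (∑ (points n) (λ x → G (Vec.tabulate (λ i → evalU F (f i) (lookup x i)))))
      ∑-points zero    []      f κ κ-min c {G} pG = ≡.subst (V (c ℕ.+ 0)) (sym (ℤₚ.+-identityʳ (G [])))
          (pG [] [])
      ∑-points (suc n) (b ∷ I) f κ κ-min c {G} pG =
        ≡.subst (V (c ℕ.+ ∑ℕ[ b ∷ I ] κ)) (sym regroup) (sum-head b pG (κ-min zero))
        where
        κ′ : ℕ
        κ′ = ∑ℕ[ I ] (λ i → κ (suc i))
        tail : Vec Carrier n → Vec Carrier n
        tail x = Vec.tabulate (λ i → evalU F (f (suc i)) (lookup x i))
        head : Carrier → Carrier
        head = evalU F (f zero)
        inner : Carrier → ℤ
        inner z = ∑ (points n) (λ x → G (z ∷ tail x))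
        regroup : ∑ (points (suc n)) (λ x → G (Vec.tabulate (λ i → evalU F (f i) (lookup x i)))) ≡ ∑ elements
            (λ x → inner (head x))
        regroup = trans (∑-concatMap (λ x → map (x ∷_) (points n)) elements
            (λ x → G (Vec.tabulate (λ i → evalU F (f i) (lookup x i)))))
          (∑-cong elements (λ x → ∑-map (x ∷_) (points n)
              (λ x → G (Vec.tabulate (λ i → evalU F (f i) (lookup x i))))))
        IH : ∀ c {G} → Differences.Prof ℤ-ring (move {I = I}) (λ t → V (c ℕ.+ t)) G → V (c ℕ.+ κ′)
            (∑ (points n) (λ x → G (tail x)))
        IH = ∑-points n I (λ i → f (suc i)) (λ i → κ (suc i)) (λ i → κ-min (suc i))
        sum-head : ∀ b → Differences.Prof ℤ-ring (move {I = b ∷ I}) (λ t → V (c ℕ.+ t)) G →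
          (b ≡ true → 0 < wU p (f zero) ∧ (∀ k → s ℕ.* suc π ≤ wU p (f zero) ℕ.* k → κ zero ≤ k)) →
          V (c ℕ.+ ∑ℕ[ b ∷ I ] κ) (∑ elements (λ x → inner (head x)))
        -- A coordinate outside the subset gains no order: the sum over it is estimated term by
        -- term.
        sum-head false pG _ = V-∑ (c ℕ.+ κ′) elements (λ x → IH c (λ ms y →
          ≡.subst₂ (λ t z → V (c ℕ.+ t) z) (Listₚ.length-map in-tail ms)
              (sym (Δ-in-tail {b = false} {I} ms G (head x) y))
            (pG (map in-tail ms) (head x ∷ y))))
        sum-head true pG min with wU p (f zero) in w≡ | min refl
        ... | suc w | _ , κ-least = lower (∑-elements (c ℕ.+ κ′) w deg prof)
          where
          deg : Degree.Deg ring _+_ (suc w) head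
          deg = ≡.subst (λ w → Degree.Deg ring _+_ w head) w≡
            (PolynomialDegree.Deg-evalU F {π} {s} prime card≡ _+_ (f zero) (λ h → h , λ y → refl))
          prof : T.Prof (λ t → V (c ℕ.+ κ′ ℕ.+ t)) inner
          prof hs z = ≡.subst₂ V arith (sym expand) (IH (c ℕ.+ length hs) prof′)
            where
            module D = Differences ℤ-ring (move {I = true ∷ I})
            arith : c ℕ.+ length hs ℕ.+ κ′ ≡ c ℕ.+ κ′ ℕ.+ length hs
            arith = trans (ℕₚ.+-assoc c (length hs) κ′)
                (trans (cong (c ℕ.+_) (ℕₚ.+-comm (length hs) κ′)) (sym (ℕₚ.+-assoc c κ′ (length hs))))
            G′ : Vec Carrier n → ℤ
            G′ y = D.Δ (map shift-head hs) G (z ∷ y)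
            expand : T.Δ hs inner z ≡ ∑ (points n) (λ x → G′ (tail x))
            expand = trans (Δ-∑ _+_ hs (points n) (λ x z → G (z ∷ tail x)) z)
              (∑-cong (points n) (λ x → Δ-shift-head {I = I} hs G z (tail x)))
            prof′ : Differences.Prof ℤ-ring (move {I = I}) (λ t → V (c ℕ.+ length hs ℕ.+ t)) G′
            prof′ ms y = ≡.subst₂ V
              (trans (cong (c ℕ.+_) (trans (Listₚ.length-++ (map shift-head hs))
                  (cong₂ ℕ._+_ (Listₚ.length-map shift-head hs) (Listₚ.length-map in-tail ms))))
                (sym (ℕₚ.+-assoc c (length hs) (length ms))))
              (sym (trans (Δ-in-tail {b = true} {I} ms (D.Δ (map shift-head hs) G) z y)
                  (D.Δ-++ (map shift-head hs) (map in-tail ms) G (z ∷ y))))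
              (pG (map shift-head hs ++ map in-tail ms) (z ∷ y))
          lower : (∃ λ k → s ℕ.* suc π ≤ suc w ℕ.* k ∧ V (c ℕ.+ κ′ ℕ.+ k) (∑ elements (λ x → inner (head x)))) →
                  V (c ℕ.+ (κ zero ℕ.+ κ′)) (∑ elements (λ x → inner (head x)))
          lower (k , le , v) = V.anti-≤ (ℕₚ.≤-trans
              (ℕₚ.≤-reflexive (trans (cong (c ℕ.+_) (ℕₚ.+-comm (κ zero) κ′)) (sym (ℕₚ.+-assoc c κ′ (κ zero)))))
            (ℕₚ.+-monoʳ-≤ (c ℕ.+ κ′) (κ-least k le))) v

    indicator : Carrier → ℤ
    indicator x with x ≟ 0#
    ... | yes _ = 1ℤ
    ... | no  _ = 0ℤ

    indicator-0 : ∀ {x} → x ≡ 0# → indicator x ≡ 1ℤ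
    indicator-0 {x} x≡0 with x ≟ 0#
    ... | yes _   = refl
    ... | no  x≢0 = ⊥-elim (x≢0 x≡0)

    indicator-≢ : ∀ {x} → x ≢ 0# → indicator x ≡ 0ℤ
    indicator-≢ {x} x≢0 with x ≟ 0#
    ... | yes x≡0 = ⊥-elim (x≢0 x≡0)
    ... | no  _   = refl

    coordinates : ∀ n → Vec (Vec Carrier n → Carrier) n
    coordinates n = Vec.tabulate (λ i y → lookup y i)

    lookup-move : ∀ {n} (I : Subset n) i → PolynomialDegree.Coordinate F {π} {s} prime card≡ (move {I = I})
        (lookup I i) (λ y → lookup y i)
    lookup-move I i = classify (lookup I i) refl
      where
      affine : ∀ {n} (I : Subset n) i (m : Move I) → ∃ λ h → ∀ y → lookup (move m y) i ≡ h + lookup y i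
      affine (_ ∷ I) zero    (shift-head h)  = h , λ { (x ∷ y) → refl }
      affine (_ ∷ I) (suc i) (shift-head h)  = 0# , λ { (x ∷ y) → sym (K.+-identityˡ _) }
      affine (_ ∷ I) zero    (in-tail m) = 0# , λ { (x ∷ y) → sym (K.+-identityˡ _) }
      affine (_ ∷ I) (suc i) (in-tail m) = let (h , e) = affine I i m in h , λ { (x ∷ y) → e y }
      invariant : ∀ {n} (I : Subset n) i → lookup I i ≡ false → ∀ (m : Move I) y → lookup
          (move m y) i ≡ lookup y i
      invariant (true ∷ I) zero    ()  (shift-head h)
      invariant (_ ∷ I)    (suc i) i∉  (shift-head h)  (x ∷ y) = refl
      invariant (_ ∷ I)    zero    i∉  (in-tail m) (x ∷ y) = refl
      invariant (_ ∷ I)    (suc i) i∉  (in-tail m) (x ∷ y) = invariant I i i∉ m y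
      classify : ∀ b → lookup I i ≡ b → PolynomialDegree.Coordinate F {π} {s} prime card≡ (move {I = I}) b
          (λ y → lookup y i)
      classify true  _  = affine I i
      classify false i∉ = invariant I i i∉

    Deg-evalM-move : ∀ {n} (I : Subset n) P → Degree.Deg ring (move {I = I}) (wM p I P) (evalM F P)
    Deg-evalM-move {n} I P = Degree.Deg-cong ring (move {I = I}) (λ y → cong (evalM F P) (at-coordinates y))
      (Deg-evalM I (coordinates n)
        (λ i → ≡.subst (Coordinate (lookup I i)) (sym (Vecₚ.lookup∘tabulate (λ i y → lookup y i) i))
            (lookup-move I i)) P)
      where
      open PolynomialDegree F {π} {s} prime card≡ (move {I = I})
      at-coordinates : ∀ y → at (coordinates n) y ≡ y
      at-coordinates y = trans (sym (Vecₚ.tabulate-∘ (λ u → u y) (λ i y → lookup y i))) (Vecₚ.tabulate∘lookup y)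

    -- The characteristic function of the zero set is a product of indicators, whose offsets add up
    -- to d; its sum over all points reaches the total order of the κ i. The maximum enters through
    -- D + 1 to keep the slope positive.
    zeroCount-divisible : ∀ {n r} (P : Fin r → MPoly F n) (I : Subset n) (f : Fin n → UPoly F)
        (κ : Fin n → ℕ) D →
      maxℕ r (λ j → wM p I (P j)) ≤ suc D →
      (∀ i → lookup I i ≡ true → 0 < wU p (f i) ∧ (∀ k → s ℕ.* suc π ≤ wU p (f i) ℕ.* k → κ i ≤ k)) →
      ∃ λ e → ∑ℕ[ I ] κ ≤ ∑ℕ r (λ j → wM p I (P j) ℕ.*
          (s ℕ.* suc π)) ℕ.+ suc D ℕ.* suc π ℕ.* e ∧ p ℕ.^ e ∣ zeroCount F P f
    zeroCount-divisible {n} {r} P I f κ D max≤ κ-min = conclude (∑-points d D n I f κ κ-min 0 prof)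
      where
      d : ℕ
      d = ∑ℕ r (λ j → wM p I (P j) ℕ.* (s ℕ.* suc π))
      G : Vec Carrier n → ℤ
      G y = ∏ r (λ j → indicator (evalM F (P j) y))
      prof : Differences.Prof ℤ-ring (move {I = I}) (×ℤ.Val p d (suc D ℕ.* suc π)) G
      prof = Prof-∏ (move {I = I}) (π ℕ.+ D ℕ.* suc π) r (λ j → wM p I (P j) ℕ.* (s ℕ.* suc π))
          (λ j y → indicator (evalM F (P j) y))
        (λ j → Prof-∘ (move {I = I}) indicator D (ℕₚ.≤-trans (≤-maxℕ r (λ j → wM p I (P j)) j) max≤)
            (Deg-evalM-move I (P j)))
      values : Vec Carrier n → Vec Carrier n
      values x = Vec.tabulate (λ i → evalU F (f i) (lookup x i))
      count : + zeroCount F P f ≡ ∑ (points n) (λ x → G (values x))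
      count = length-filter-∑ (λ x → Finₚ.all? (λ j → evalM F (P j) (values x) ≟ 0#)) (λ x → G (values x))
        (λ x zs → ∏-one r (λ j → indicator-0 (zs j)))
        (λ x ¬zs → let (j , ¬z) = Finₚ.¬∀⟶∃¬ r _ (λ j → evalM F (P j) (values x) ≟ 0#) ¬zs in ∏-zero r j
            (indicator-≢ ¬z))
        (points n)
      conclude : ×ℤ.Val p d (suc D ℕ.* suc π) (∑ℕ[ I ] κ) (∑ (points n) (λ x → G (values x))) → _
      conclude (e , le , q , eq) = e , le , Div⇒∣ (q , trans count eq)

-- Arithmetic of the exponent

open import Data.Nat using (_^_)

ι : ℕ → ℚ
ι n = + n ℚ./ 1

fromℚᵘ-+ : ∀ a b → fromℚᵘ (a ℚᵘ.+ b) ≡ fromℚᵘ a ℚ.+ fromℚᵘ b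
fromℚᵘ-+ a b = ℚₚ.toℚᵘ-injective (ℚᵘₚ.≃-trans (ℚₚ.toℚᵘ-fromℚᵘ (a ℚᵘ.+ b)) (ℚᵘₚ.≃-sym
  (ℚᵘₚ.≃-trans (ℚₚ.toℚᵘ-homo-+ (fromℚᵘ a) (fromℚᵘ b)) (ℚᵘₚ.+-cong (ℚₚ.toℚᵘ-fromℚᵘ a) (ℚₚ.toℚᵘ-fromℚᵘ b)))))

fromℚᵘ-* : ∀ a b → fromℚᵘ (a ℚᵘ.* b) ≡ fromℚᵘ a ℚ.* fromℚᵘ b
fromℚᵘ-* a b = ℚₚ.toℚᵘ-injective (ℚᵘₚ.≃-trans (ℚₚ.toℚᵘ-fromℚᵘ (a ℚᵘ.* b)) (ℚᵘₚ.≃-sym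
  (ℚᵘₚ.≃-trans (ℚₚ.toℚᵘ-homo-* (fromℚᵘ a) (fromℚᵘ b)) (ℚᵘₚ.*-cong (ℚₚ.toℚᵘ-fromℚᵘ a) (ℚₚ.toℚᵘ-fromℚᵘ b)))))

ι-+ : ∀ m n → ι (m ℕ.+ n) ≡ ι m ℚ.+ ι n
ι-+ m n = trans (ℚₚ.fromℚᵘ-cong {mkℚᵘ (+ (m ℕ.+ n)) 0} {mkℚᵘ (+ m) 0 ℚᵘ.+ mkℚᵘ (+ n) 0}
  (*≡* (cong (ℤ._* + 1) (sym (cong₂ ℤ._+_ (ℤₚ.*-identityʳ (+ m)) (ℤₚ.*-identityʳ (+ n)))))))
  (fromℚᵘ-+ (mkℚᵘ (+ m) 0) (mkℚᵘ (+ n) 0))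

ι-* : ∀ m n → ι (m ℕ.* n) ≡ ι m ℚ.* ι n
ι-* m n = trans (ℚₚ.fromℚᵘ-cong {mkℚᵘ (+ (m ℕ.* n)) 0} {mkℚᵘ (+ m) 0 ℚᵘ.* mkℚᵘ (+ n) 0}
  (*≡* (cong (ℤ._* + 1) (ℤₚ.pos-* m n))))
  (fromℚᵘ-* (mkℚᵘ (+ m) 0) (mkℚᵘ (+ n) 0))

ι-mono : ∀ {m n} → m ≤ n → ι m ℚ.≤ ι n
ι-mono {m} {n} m≤n = ℚₚ.toℚᵘ-cancel-≤ (ℚᵘₚ.≤-respˡ-≃ (ℚᵘₚ.≃-sym (ℚₚ.toℚᵘ-fromℚᵘ (mkℚᵘ (+ m) 0)))
  (ℚᵘₚ.≤-respʳ-≃ (ℚᵘₚ.≃-sym (ℚₚ.toℚᵘ-fromℚᵘ (mkℚᵘ (+ n) 0)))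
    (ℚᵘ.*≤* (ℤₚ.*-monoʳ-≤-nonNeg (+ 1) (ℤ.+≤+ m≤n)))))

ι-nonNeg : ∀ n → ℚ.NonNegative (ι n)
ι-nonNeg n = ℚₚ.normalize-nonNeg n 1

recip-nonNeg : ∀ n → ℚ.NonNegative (recip n)
recip-nonNeg zero    = _
recip-nonNeg (suc n) = ℚₚ.normalize-nonNeg 1 (suc n)

ι*recip : ∀ n → ι (suc n) ℚ.* recip (suc n) ≡ 1ℚ
ι*recip n = trans (sym (fromℚᵘ-* (mkℚᵘ (+ suc n) 0) (mkℚᵘ (+ 1) n)))
  (ℚₚ.fromℚᵘ-cong {mkℚᵘ (+ suc n) 0 ℚᵘ.* mkℚᵘ (+ 1) n} {mkℚᵘ (+ 1) 0}
    (*≡* (trans (ℤₚ.*-identityʳ _) (trans (ℤₚ.*-identityʳ (+ suc n))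
        (sym (trans (ℤₚ.*-identityˡ _) (ℤₚ.*-identityˡ (+ suc n))))))))

ι*recip≤ : ∀ {a w k} → a ≤ suc w ℕ.* k → ι a ℚ.* recip (suc w) ℚ.≤ ι k
ι*recip≤ {a} {w} {k} a≤ = begin
  ι a ℚ.* recip (suc w)                      ≤⟨ ℚₚ.*-monoʳ-≤-nonNeg (recip (suc w)) {{recip-nonNeg (suc w)}}
      (ι-mono a≤) ⟩
  ι (suc w ℕ.* k) ℚ.* recip (suc w)          ≡⟨ cong (ℚ._* recip (suc w))
      (trans (ι-* (suc w) k) (ℚₚ.*-comm (ι (suc w)) (ι k))) ⟩
  ι k ℚ.* ι (suc w) ℚ.* recip (suc w)        ≡⟨ ℚₚ.*-assoc (ι k) (ι (suc w)) (recip (suc w)) ⟩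
  ι k ℚ.* (ι (suc w) ℚ.* recip (suc w))      ≡⟨ cong (ι k ℚ.*_) (ι*recip w) ⟩
  ι k ℚ.* 1ℚ                                 ≡⟨ ℚₚ.*-identityʳ (ι k) ⟩
  ι k                                        ∎
  where open ℚₚ.≤-Reasoning

floor-greatest : ∀ q i → i ℤ.* ↧ q ℤ.≤ ↥ q → i ℤ.≤ floor q
floor-greatest q@record{} i le = ≡.subst (i ℤ.≤_) (sym (ℤDivMod.div-pos-is-/ℕ (↥ q) (ℚ.↧ₙ q)))
  (≡.subst (i ℤ.≤_) (ℤₚ.pred-suc (↥ q ℤ./ℕ ℚ.↧ₙ q)) (ℤₚ.i<j⇒i≤pred[j]
    (ℤₚ.*-cancelʳ-<-nonNeg {i} {ℤ.suc (↥ q ℤ./ℕ ℚ.↧ₙ q)} (↧ q)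
        (ℤₚ.≤-<-trans le (ℤDivMod.n<s[n/ℕd]*d (↥ q) (ℚ.↧ₙ q))))))

floor-nonPositive : ∀ q → ↥ q ℤ.≤ 0ℤ → floor q ℤ.≤ 0ℤ
floor-nonPositive q@record{} le = ℤₚ.*-cancelʳ-≤-pos (floor q) 0ℤ (↧ q)
    (ℤₚ.≤-trans (ℤDivMod.[n/d]*d≤n (↥ q) (↧ q)) le)

≤ι⇒ : ∀ x e → x ℚ.≤ ι e → ↥ x ℤ.≤ + e ℤ.* ↧ x
≤ι⇒ x@record{} e le with ℚᵘₚ.≤-respʳ-≃ (ℚₚ.toℚᵘ-fromℚᵘ (mkℚᵘ (+ e) 0)) (ℚₚ.toℚᵘ-mono-≤ le)
... | ℚᵘ.*≤* le′ = ≡.subst (ℤ._≤ + e ℤ.* ↧ x) (ℤₚ.*-identityʳ (↥ x)) le′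

-- The ceiling is -floor (-x), hence the bounds on the floor of -x. Nonnegativity of x keeps the
-- absolute value from turning a negative exponent into a large one.
∣ceiling∣≤ : ∀ x e → 0ℚ ℚ.≤ x → x ℚ.≤ ι e → ℤ.∣ ceiling x ∣ ≤ e
∣ceiling∣≤ x@record{} e 0≤x x≤e = bounded (ceiling x) (ℤₚ.neg-mono-≤ nonPositive)
  (≡.subst (ceiling x ℤ.≤_) (ℤₚ.neg-involutive (+ e)) (ℤₚ.neg-mono-≤ lower))
  where
  bounded : ∀ z → 0ℤ ℤ.≤ z → z ℤ.≤ + e → ℤ.∣ z ∣ ≤ e
  bounded (+ k) _ (ℤ.+≤+ k≤e) = k≤e
  nonPositive : floor (ℚ.- x) ℤ.≤ 0ℤ
  nonPositive = floor-nonPositive (ℚ.- x) (≡.subst (ℤ._≤ 0ℤ) (sym (ℚₚ.↥-neg x))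
    (ℤₚ.neg-mono-≤ (ℤₚ.nonNegative⁻¹ (↥ x) {{ℚ.nonNegative 0≤x}})))
  lower : ℤ.- (+ e) ℤ.≤ floor (ℚ.- x)
  lower = floor-greatest (ℚ.- x) (ℤ.- (+ e)) (≡.subst₂ ℤ._≤_
    (trans (ℤₚ.neg-distribˡ-* (+ e) (↧ x)) (cong (ℤ.- (+ e) ℤ.*_) (sym (ℚₚ.↧-neg x)))) (sym (ℚₚ.↥-neg x))
    (ℤₚ.neg-mono-≤ (≤ι⇒ x e x≤e)))

0≤p-q : ∀ {p q} → q ℚ.≤ p → 0ℚ ℚ.≤ p ℚ.- q
0≤p-q {p} {q} q≤p = ≡.subst (ℚ._≤ p ℚ.- q) (ℚₚ.+-inverseʳ q) (ℚₚ.+-monoˡ-≤ (ℚ.- q) q≤p)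

module _ (s π N D : ℕ) (S : ℚ) where
  private
    X : ℚ
    X = ι s ℚ.* (S ℚ.- ι N) ℚ.* recip (suc D)

  exponent-nonNeg : ι N ℚ.≤ S → 0ℚ ℚ.≤ X
  exponent-nonNeg le = ℚₚ.nonNegative⁻¹ X {{ℚₚ.nonNeg*nonNeg⇒nonNeg (ι s ℚ.* (S ℚ.- ι N))
    {{ℚₚ.nonNeg*nonNeg⇒nonNeg (ι s) {{ι-nonNeg s}} (S ℚ.- ι N) {{ℚ.nonNegative (0≤p-q le)}}}}
        (recip (suc D)) {{recip-nonNeg (suc D)}}}}

  -- Every term carries the factor p - 1. Once it is cancelled, s N moves to the left and the
  -- division by D + 1 remains.
  exponent≤ : ∀ e → ι (s ℕ.* suc π) ℚ.* S ℚ.≤ ι (N ℕ.* (s ℕ.* suc π) ℕ.+ suc D ℕ.* suc π ℕ.* e) → X ℚ.≤ ι e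
  exponent≤ e le = begin
    ι s ℚ.* (S ℚ.- ι N) ℚ.* recip (suc D)        ≤⟨ ℚₚ.*-monoʳ-≤-nonNeg
        (recip (suc D)) {{recip-nonNeg (suc D)}} difference ⟩
    ι (suc D) ℚ.* ι e ℚ.* recip (suc D)          ≡⟨ swap (ι (suc D)) (ι e) (recip (suc D)) ⟩
    ι (suc D) ℚ.* recip (suc D) ℚ.* ι e          ≡⟨ cong (ℚ._* ι e) (ι*recip D) ⟩
    1ℚ ℚ.* ι e                                   ≡⟨ ℚₚ.*-identityˡ (ι e) ⟩
    ι e                                          ∎
    where
    open ℚₚ.≤-Reasoning
    open +-*-Solver
    swap : ∀ a b c → a ℚ.* b ℚ.* c ≡ a ℚ.* c ℚ.* b
    swap = solve 3 (λ a b c → a :* b :* c := a :* c :* b) refl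
    lhs : ∀ s π S → s ℚ.* π ℚ.* S ≡ π ℚ.* (s ℚ.* S)
    lhs = solve 3 (λ s π S → s :* π :* S := π :* (s :* S)) refl
    rhs : ∀ N s π D e → N ℚ.* (s ℚ.* π) ℚ.+ D ℚ.* π ℚ.* e ≡ π ℚ.* (s ℚ.* N ℚ.+ D ℚ.* e)
    rhs = solve 5 (λ N s π D e → N :* (s :* π) :+ D :* π :* e := π :* (s :* N :+ D :* e)) refl
    cancel : ∀ s S N → s ℚ.* (S ℚ.- N) ≡ s ℚ.* S ℚ.- s ℚ.* N
    cancel = solve 3 (λ s S N → s :* (S :- N) := s :* S :- s :* N) refl
    cancel′ : ∀ a b → a ℚ.+ b ℚ.- a ≡ b
    cancel′ = solve 2 (λ a b → a :+ b :- a := b) refl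
    scaled : ι (suc π) ℚ.* (ι s ℚ.* S) ℚ.≤ ι (suc π) ℚ.* (ι s ℚ.* ι N ℚ.+ ι (suc D) ℚ.* ι e)
    scaled = ≡.subst₂ ℚ._≤_ (trans (cong (ℚ._* S) (ι-* s (suc π))) (lhs (ι s) (ι (suc π)) S))
      (trans (ι-+ (N ℕ.* (s ℕ.* suc π)) (suc D ℕ.* suc π ℕ.* e))
        (trans (cong₂ ℚ._+_ (trans (ι-* N (s ℕ.* suc π)) (cong (ι N ℚ.*_) (ι-* s (suc π))))
            (trans (ι-* (suc D ℕ.* suc π) e) (cong (ℚ._* ι e) (ι-* (suc D) (suc π)))))
          (rhs (ι N) (ι s) (ι (suc π)) (ι (suc D)) (ι e)))) le
    difference : ι s ℚ.* (S ℚ.- ι N) ℚ.≤ ι (suc D) ℚ.* ι e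
    difference = ≡.subst₂ ℚ._≤_ (sym (cancel (ι s) S (ι N))) (cancel′ (ι s ℚ.* ι N) (ι (suc D) ℚ.* ι e))
      (ℚₚ.+-monoˡ-≤ (ℚ.- (ι s ℚ.* ι N)) (ℚₚ.*-cancelˡ-≤-pos (ι (suc π)) {{ℚₚ.normalize-pos (suc π) 1}} scaled))

∑ℕ-*ʳ : ∀ r (w : Fin r → ℕ) a → ∑ℕ r (λ j → w j ℕ.* a) ≡ ∑ℕ r w ℕ.* a
∑ℕ-*ʳ zero    w a = refl
∑ℕ-*ʳ (suc r) w a = trans (cong (w zero ℕ.* a ℕ.+_) (∑ℕ-*ʳ r (λ j → w (suc j)) a))
  (sym (ℕₚ.*-distribʳ-+ a (w zero) (∑ℕ r (λ j → w (suc j)))))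

-- Denominator 0 has the default value 0, in step with `recip`.
⌈_/_⌉ : ℕ → ℕ → ℕ
⌈ a / zero  ⌉ = 0
⌈ a / suc w ⌉ = (a ℕ.+ w) ℕ./ suc w

≤*⌈/⌉ : ∀ a w → a ≤ suc w ℕ.* ⌈ a / suc w ⌉
≤*⌈/⌉ a w = ℕₚ.+-cancelʳ-≤ w a (suc w ℕ.* q) (begin
  a ℕ.+ w                      ≡⟨ DivMod.m≡m%n+[m/n]*n (a ℕ.+ w) (suc w) ⟩
  (a ℕ.+ w) ℕ.% suc w ℕ.+ q ℕ.* suc w ≤⟨ ℕₚ.+-monoˡ-≤ (q ℕ.* suc w) (ℕ.s≤s⁻¹ (DivMod.m%n<n (a ℕ.+ w) (suc w))) ⟩
  w ℕ.+ q ℕ.* suc w            ≡⟨ trans (ℕₚ.+-comm w _) (cong (ℕ._+ w) (ℕₚ.*-comm q (suc w))) ⟩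
  suc w ℕ.* q ℕ.+ w            ∎)
  where
  open ℕₚ.≤-Reasoning
  q = (a ℕ.+ w) ℕ./ suc w

⌈/⌉-least : ∀ a w k → a ≤ suc w ℕ.* k → ⌈ a / suc w ⌉ ≤ k
⌈/⌉-least a w k a≤ = ℕ.s≤s⁻¹ (DivMod.m<n*o⇒m/o<n (begin-strict
  a ℕ.+ w               ≤⟨ ℕₚ.+-monoˡ-≤ w a≤ ⟩
  suc w ℕ.* k ℕ.+ w     <⟨ ℕₚ.+-monoʳ-< (suc w ℕ.* k) (ℕₚ.n<1+n w) ⟩
  suc w ℕ.* k ℕ.+ suc w ≡⟨ trans (ℕₚ.+-comm _ (suc w)) (cong (suc w ℕ.+_) (ℕₚ.*-comm (suc w) k)) ⟩
  suc k ℕ.* suc w       ∎))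
  where open ℕₚ.≤-Reasoning

ι*∑recip≤ : ∀ n (I : Subset n) (w : Fin n → ℕ) a → (∀ i → lookup I i ≡ true → 0 < w i) →
            ι a ℚ.* ∑ℚ[ I ] (λ i → recip (w i)) ℚ.≤ ι (∑ℕ[ I ] (λ i → ⌈ a / w i ⌉))
ι*∑recip≤ zero    []      w a pos = ℚₚ.≤-reflexive (ℚₚ.*-zeroʳ (ι a))
ι*∑recip≤ (suc n) (b ∷ I) w a pos = begin
  ι a ℚ.* (term ℚ.+ rest)                ≡⟨ ℚₚ.*-distribˡ-+ (ι a) term rest ⟩
  ι a ℚ.* term ℚ.+ ι a ℚ.* rest          ≤⟨ ℚₚ.+-mono-≤ (first b (pos zero))
      (ι*∑recip≤ n I (λ i → w (suc i)) a (λ i → pos (suc i))) ⟩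
  ι termᶜ ℚ.+ ι restᶜ                    ≡⟨ ι-+ termᶜ restᶜ ⟨
  ι (termᶜ ℕ.+ restᶜ)                    ∎
  where
  open ℚₚ.≤-Reasoning
  term = if b then recip (w zero) else 0ℚ
  rest = ∑ℚ[ I ] (λ i → recip (w (suc i)))
  termᶜ = if b then ⌈ a / w zero ⌉ else 0
  restᶜ = ∑ℕ[ I ] (λ i → ⌈ a / w (suc i) ⌉)
  first : ∀ b → (b ≡ true → 0 < w zero) →
          ι a ℚ.* (if b then recip (w zero) else 0ℚ) ℚ.≤ ι (if b then ⌈ a / w zero ⌉ else 0)
  first false _ = ℚₚ.≤-reflexive (ℚₚ.*-zeroʳ (ι a))
  first true pos with w zero | pos refl
  ... | suc w₀ | _ = ι*recip≤ {a} {w₀} (≤*⌈/⌉ a w₀)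

-- If the last digit is 0, then m is the base times the quotient, so the quotient is again nonzero.
σ-fuel-positive : ∀ b k m → m ≤ k → m ≢ 0 → 0 < σ-fuel k (suc (suc b)) m
σ-fuel-positive b zero    zero z≤n m≢0 = ⊥-elim (m≢0 refl)
σ-fuel-positive b (suc k) zero m≤k m≢0 = ⊥-elim (m≢0 refl)
σ-fuel-positive b (suc k) m@(suc _) m≤k m≢0 with m ℕ.% suc (suc b) in rem
... | suc _ = s≤s z≤n
... | zero  = σ-fuel-positive b k (m ℕ./ suc (suc b))
  (ℕ.s≤s⁻¹ (ℕₚ.≤-trans (DivMod.m/n<m m (suc (suc b)) (s≤s (s≤s z≤n))) m≤k))
  (λ q≡0 → m≢0 (trans (DivMod.m≡m%n+[m/n]*n m (suc (suc b))) (cong₂ (λ x y → x ℕ.+ y ℕ.* suc (suc b)) rem q≡0)))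

wU-positive : ∀ (F : FiniteField) b f → Nonconstant F f → 0 < wU (suc (suc b)) f
wU-positive F b ((_ , m) ∷ f) (here m≢0)  = ℕₚ.<-≤-trans (σ-fuel-positive b m m ℕₚ.≤-refl m≢0) (ℕₚ.m≤m⊔n _ _)
wU-positive F b ((_ , m) ∷ f) (there non) = ℕₚ.<-≤-trans (wU-positive F b f non)
    (ℕₚ.m≤n⊔m (σ (suc (suc b)) m) _)

^-monoʳ-∣ : ∀ p {a b} → a ≤ b → p ^ a ∣ p ^ b
^-monoʳ-∣ p {a} {b} a≤b = ∣.divides (p ^ (b ℕ.∸ a))
    (trans (cong (p ^_) (sym (ℕₚ.m∸n+n≡m a≤b))) (ℕₚ.^-distribˡ-+-* p (b ℕ.∸ a) a))

theorem1p18 : (F : FiniteField) (p s : ℕ) → Prime p → FiniteField.card F ≡ p ^ s →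
    (n r : ℕ) (P : Fin r → MPoly F n) →
    (∀ j → WellFormedM F (P j)) → (∀ j → P j ≢ []) →
    (I : Subset n) → Nonempty I →
    0 < maxℕ r (λ j → wM p I (P j)) →
    (f : Fin n → UPoly F) → (∀ i → WellFormedU F (f i)) →
    (∀ i → i ∈ I → Nonconstant F (f i)) →
    (+ ∑ℕ r (λ j → wM p I (P j)) ℚ./ 1) ℚ.≤ ∑ℚ[ I ] (λ i → recip (wU p (f i))) →
    p ^ ℤ.∣ ceiling ((+ s ℚ./ 1) ℚ.* (∑ℚ[ I ] (λ i → recip (wU p (f i))) ℚ.- (+ ∑ℕ r (λ j → wM p I (P j)) ℚ./ 1)) ℚ.* recip (maxℕ r (λ j → wM p I (P j)))) ∣
    ∣ zeroCount F P f
theorem1p18 F zero          s pr = ⊥-elim (¬prime[0] pr)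
theorem1p18 F (suc zero)    s pr = ⊥-elim (¬prime[1] pr)
theorem1p18 F p@(suc (suc π)) s pr card≡ n r P _ _ I _ 0<max f _ nonconstant N≤S
  with maxℕ r (λ j → wM p I (P j)) in max≡
-- Positivity of the maximal weight permits writing it as D + 1, which then serves as the common
-- slope.
... | suc D = conclude (zeroCount-divisible P I f κ D (ℕₚ.≤-reflexive max≡) κ-min)
  where
  open Zeros F {π} {s} pr card≡ using (module Divisibility; field-basis)
  open Divisibility field-basis using (zeroCount-divisible)
  N = ∑ℕ r (λ j → wM p I (P j))
  S = ∑ℚ[ I ] (λ i → recip (wU p (f i)))
  X = ι s ℚ.* (S ℚ.- ι N) ℚ.* recip (suc D)
  κ : Fin n → ℕ
  κ i = ⌈ s ℕ.* suc π / wU p (f i) ⌉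
  positive : ∀ i → lookup I i ≡ true → 0 < wU p (f i)
  positive i i∈ = wU-positive F π (f i) (nonconstant i (Vecₚ.lookup⇒[]= i I i∈))
  κ-min : ∀ i → lookup I i ≡ true → 0 < wU p (f i) ∧ (∀ k → s ℕ.* suc π ≤ wU p (f i) ℕ.* k → κ i ≤ k)
  κ-min i i∈ with wU p (f i) | positive i i∈
  ... | suc w | 0<w = 0<w , ⌈/⌉-least (s ℕ.* suc π) w
  conclude : (∃ λ e → ∑ℕ[ I ] κ ≤ ∑ℕ r (λ j → wM p I (P j) ℕ.*
      (s ℕ.* suc π)) ℕ.+ suc D ℕ.* suc π ℕ.* e ∧ p ^ e ∣ zeroCount F P f) →
             p ^ ℤ.∣ ceiling X ∣ ∣ zeroCount F P f
  conclude (e , le , div) = ∣.∣-trans (^-monoʳ-∣ p small) div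
    where
    -- Rounding goes in the right direction: the sum of the κ i is at least s (p - 1) times the sum
    -- of the reciprocals.
    bound : X ℚ.≤ ι e
    bound = exponent≤ s π N D S e (ℚₚ.≤-trans (ι*∑recip≤ n I (λ i → wU p (f i)) (s ℕ.* suc π) positive)
      (ι-mono (ℕₚ.≤-trans le (ℕₚ.≤-reflexive (cong (ℕ._+ suc D ℕ.* suc π ℕ.* e)
          (∑ℕ-*ʳ r (λ j → wM p I (P j)) (s ℕ.* suc π)))))))
    small : ℤ.∣ ceiling X ∣ ≤ e
    small = ∣ceiling∣≤ X e (exponent-nonNeg s π N D S N≤S) bound
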